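{- For all $a,m\in\mathbb{N}$ and $n\in\mathbb{N}_0$, $\mathrm{cp}^o_{a,a,m}(n)\le \mathrm{cp}^e_{a,a,m}(n)$. Equivalently, the $q$-series $$\frac{(-q^{2a};q^m)_\infty}{(-q^a;q^m)_\infty(q^a;q^m)_\infty}$$ has non-negative coefficients.
   Context: A partition of $n$ is a non-increasing finite sequence of positive integers summing to $n$; $\nu(\lambda)$ denotes its number of parts and $|\lambda|$ its sum. For $a,b,m\in\mathbb{N}$, an $(a,b,m)$-copartition is a triple of partitions $(\gamma,\rho,\sigma)$ such that every part of $\gamma$ (the "ground") is $\equiv a \pmod m$ and at least $a$, every part of $\sigma$ (the "sky") is $\equiv b\pmod m$ and at least $b$, and $\rho$ consists of exactly $\nu(\sigma)$ parts each equal to $m\cdot\nu(\gamma)$ (these contribute nothing when $\gamma$ is empty). Its size is $|\gamma|+|\rho|+|\sigma|$. $\mathrm{cp}^o_{a,b,m}(n)$ (resp. $\mathrm{cp}^e_{a,b,m}(n)$) is the number of $(a,b,m)$-copartitions of size $n$ whose ground has an odd (resp. even) number of parts. Notation: $(x;q)_\infty=\prod_{k\ge0}(1-xq^k)$. -}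

module Defs where

open import Data.Nat using (ℕ; zero; suc; _+_; _*_; _∸_; _≤_; _⊓_; NonZero; _≡ᵇ_; _≤ᵇ_)
open import Data.Nat.DivMod using (_%_)
open import Data.Bool using (Bool; true; false; _∧_; if_then_else_)
open import Data.List using (List; []; _∷_; [_]; map; concatMap; length; filter; upTo; applyUpTo)
open import Data.Nat.ListAction using (sum)
open import Data.List using (foldr)
open import Data.Product using (_×_; _,_)
open import Relation.Nullary.Decidable using (⌊_⌋)
open import Relation.Binary.PropositionalEquality using (_≡_)
open import Data.Bool.Properties using (_≟_)

-- A partition is represented as a list of parts.
-- partsUpTo fuel n mx : all non-increasing lists of positive integers,
-- each part ≤ mx, summing to n (complete whenever fuel ≥ n).
partsUpTo : ℕ → ℕ → ℕ → List (List ℕ)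
partsUpTo zero    zero    mx = [ [] ]
partsUpTo zero    (suc n) mx = []
partsUpTo (suc f) zero    mx = [ [] ]
partsUpTo (suc f) (suc n) mx =
  concatMap (λ p → map (p ∷_) (partsUpTo f (suc n ∸ p) p))
            (applyUpTo suc (suc n ⊓ mx))

partitions : ℕ → List (List ℕ)
partitions n = partsUpTo n n n

ν : List ℕ → ℕ
ν = length

∣_∣ₚ : List ℕ → ℕ
∣ λ′ ∣ₚ = sum λ′

partsOK : (c m : ℕ) .{{_ : NonZero m}} → List ℕ → Bool
partsOK c m = foldr (λ p r → (p % m ≡ᵇ c % m) ∧ (c ≤ᵇ p) ∧ r) true

-- An (a,b,m)-copartition (γ,ρ,σ) is determined by the pair (γ,σ):
-- ρ consists of ν(σ) copies of m·ν(γ) (contributing nothing if γ = []),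
-- so |ρ| = ν(σ) · m · ν(γ) and the size is |γ| + ν(σ)·m·ν(γ) + |σ|.
copartitionSize : (m : ℕ) → List ℕ → List ℕ → ℕ
copartitionSize m γ σ = ∣ γ ∣ₚ + ν σ * (m * ν γ) + ∣ σ ∣ₚ

copartitions : (a b m : ℕ) .{{_ : NonZero m}} → ℕ → List (List ℕ × List ℕ)
copartitions a b m n =
  concatMap (λ i →
    concatMap (λ γ →
      concatMap (λ k →
        concatMap (λ σ →
          if partsOK a m γ ∧ partsOK b m σ ∧ (copartitionSize m γ σ ≡ᵇ n)
            then [ (γ , σ) ] else [])
          (partitions k))
        (upTo (suc n)))
      (partitions i))
    (upTo (suc n))

groundOdd : List ℕ × List ℕ → Bool
groundOdd (γ , σ) = ν γ % 2 ≡ᵇ 1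

groundEven : List ℕ × List ℕ → Bool
groundEven (γ , σ) = ν γ % 2 ≡ᵇ 0

cpᵒ : (a b m : ℕ) .{{_ : NonZero m}} → ℕ → ℕ
cpᵒ a b m n = length (filter (λ x → groundOdd x ≟ true) (copartitions a b m n))

cpᵉ : (a b m : ℕ) .{{_ : NonZero m}} → ℕ → ℕ
cpᵉ a b m n = length (filter (λ x → groundEven x ≟ true) (copartitions a b m n))

{-# OPTIONS --safe #-}
module Submission where

-- Put z = q ^ a and Q = q ^ m.  If p r is the generating function of the admissible partitions into r
-- parts, copartitions with r ground and s sky parts are counted by Q ^ (r s) p r p s, and p r satisfies
-- (1 - Q ^ r) p r = z p (r - 1).  With B r s = (-1) ^ r Q ^ (r s) p r p s, the sums D k of B r s and E k of
-- Q ^ r B r s over r + s = k therefore satisfy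
--   D (k + 1) + z D k = E (k + 1) + z ^ 2 E (k - 1),
--   E (k + 1) = z E k + Q ^ (k + 1) D (k + 1) + z ^ 2 Q ^ k D (k - 1),
-- and eliminating E leaves a recurrence expressing (1 - Q ^ k) D k through earlier D with non-negative
-- coefficients.  (These are the functional equations of the infinite product, read coefficientwise in z.)

open import Defs
open import Algebra.Bundles using (CommutativeRing)
open import Algebra.Structures using (IsCommutativeRing)
open import Data.Integer.Base using (ℤ; +_; 0ℤ; 1ℤ; -_; _≤_; +≤+)
open import Data.Bool.Base using (Bool; true; false; _∧_; if_then_else_)
import Data.Bool.Properties as Bool
import Data.Integer.Base as ℤ using (_+_; _*_)
import Data.Integer.Properties as ℤ
open import Data.List.Base using (List; []; _∷_; [_]; _++_; map; concatMap; length; filter; applyUpTo; upTo)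
open import Data.Nat.Base as ℕ using (ℕ; zero; suc; z≤n; s≤s; NonZero; _∸_; _⊓_; _≡ᵇ_; _≤ᵇ_)
open import Data.Nat.DivMod using (_/_; _%_; m≡m%n+[m/n]*n; [m+kn]%n≡m%n)
open import Data.Nat.Divisibility using (divides; ∣⇒≤; ∣m+n∣m⇒∣n; n∣m*n)
import Data.Nat.Properties as ℕ
import Data.Nat.Tactic.RingSolver as ℕRing
open import Data.Product.Base using (_×_; _,_; proj₁)
open import Function.Base using (_∘_; id)
open import Function.Bundles using (Equivalence)
open import Level using (0ℓ)
open import Relation.Binary.PropositionalEquality
  using (_≡_; _≢_; _≗_; refl; sym; trans; cong; cong₂; subst; module ≡-Reasoning)
open import Relation.Nullary.Negation using (contradiction)

open ≡-Reasoning

-- Integer arithmetic.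

-- Opaque, so that unification can decompose sums and products.
opaque
  infixl 6 _+_
  infixl 7 _*_

  _+_ _*_ : ℤ → ℤ → ℤ
  _+_ = ℤ._+_
  _*_ = ℤ._*_

  +-*-isCommutativeRing : IsCommutativeRing _≡_ _+_ _*_ -_ 0ℤ 1ℤ
  +-*-isCommutativeRing = ℤ.+-*-isCommutativeRing

  +-nonneg : ∀ {i j} → 0ℤ ≤ i → 0ℤ ≤ j → 0ℤ ≤ i + j
  +-nonneg = ℤ.+-mono-≤

  *-nonneg : ∀ {i j} → 0ℤ ≤ i → 0ℤ ≤ j → 0ℤ ≤ i * j
  *-nonneg {+ i} {+ j} _ _ = subst (0ℤ ≤_) (ℤ.pos-* i j) (+≤+ z≤n)

  i≤i+j : ∀ i {j} → 0ℤ ≤ j → i ≤ i + j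
  i≤i+j i {j} 0≤j = subst (_≤ i ℤ.+ j) (ℤ.+-identityʳ i) (ℤ.+-monoʳ-≤ i 0≤j)

  pos-+ : ∀ m n → + (m ℕ.+ n) ≡ + m + + n
  pos-+ = ℤ.pos-+

+-*-commutativeRing : CommutativeRing 0ℓ 0ℓ
+-*-commutativeRing = record { isCommutativeRing = +-*-isCommutativeRing }

open CommutativeRing +-*-commutativeRing using
  ( +-commutativeMonoid; +-assoc; +-comm; +-identityˡ; +-identityʳ; distribˡ; distribʳ
  ; *-assoc; *-comm; *-identityˡ; zeroˡ; zeroʳ; -‿inverseˡ; -‿inverseʳ)

open import Algebra.Properties.Ring (CommutativeRing.ring +-*-commutativeRing) using (+-cancelʳ)

open import Algebra.Solver.CommutativeMonoid +-commutativeMonoid using (solve; _⊕_; _⊜_)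

Series : Set
Series = ℕ → ℤ

+-zero : ∀ {i j} → i ≡ 0ℤ → j ≡ 0ℤ → i + j ≡ 0ℤ
+-zero refl refl = +-identityˡ 0ℤ

interchange : ∀ (w x y z : ℤ) → (w + x) + (y + z) ≡ (w + y) + (x + z)
interchange =
  solve 4 (λ w x y z → (w ⊕ x) ⊕ (y ⊕ z) ⊜ (w ⊕ y) ⊕ (x ⊕ z)) refl

-- Finite sums over initial segments.

Σ< : ℕ → (ℕ → ℤ) → ℤ
Σ< zero    f = 0ℤ
Σ< (suc n) f = f 0 + Σ< n (f ∘ suc)

Σ<-cong : ∀ n {f g} → (∀ i → i ℕ.< n → f i ≡ g i) → Σ< n f ≡ Σ< n g
Σ<-cong zero    eq = refl
Σ<-cong (suc n) eq = cong₂ _+_ (eq 0 (s≤s z≤n)) (Σ<-cong n λ i i<n → eq (suc i) (s≤s i<n))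

Σ<-zero : ∀ n {f} → (∀ i → i ℕ.< n → f i ≡ 0ℤ) → Σ< n f ≡ 0ℤ
Σ<-zero zero    eq = refl
Σ<-zero (suc n) eq = +-zero (eq 0 (s≤s z≤n)) (Σ<-zero n λ i i<n → eq (suc i) (s≤s i<n))

Σ<-+ : ∀ n f g → Σ< n (λ i → f i + g i) ≡ Σ< n f + Σ< n g
Σ<-+ zero    f g = sym (+-identityˡ 0ℤ)
Σ<-+ (suc n) f g =
  trans (cong (_+_ _) (Σ<-+ n (f ∘ suc) (g ∘ suc))) (interchange (f 0) (g 0) _ _)

Σ<-*ˡ : ∀ n c f → Σ< n (λ i → c * f i) ≡ c * Σ< n f
Σ<-*ˡ zero    c f = sym (zeroʳ c)
Σ<-*ˡ (suc n) c f =
  trans (cong (_+_ _) (Σ<-*ˡ n c (f ∘ suc))) (sym (distribˡ c (f 0) _))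

Σ<-split : ∀ n d f → Σ< (n ℕ.+ d) f ≡ Σ< n f + Σ< d (λ i → f (n ℕ.+ i))
Σ<-split zero    d f = sym (+-identityˡ _)
Σ<-split (suc n) d f =
  trans (cong (_+_ _) (Σ<-split n d (f ∘ suc))) (sym (+-assoc (f 0) _ _))

Σ<-last : ∀ n f → Σ< (suc n) f ≡ Σ< n f + f n
Σ<-last zero    f = +-comm (f 0) 0ℤ
Σ<-last (suc n) f =
  trans (cong (_+_ _) (Σ<-last n (f ∘ suc))) (sym (+-assoc (f 0) _ _))

Σ<-swap : ∀ m n (f : ℕ → ℕ → ℤ) →
          Σ< m (λ i → Σ< n (λ j → f i j)) ≡ Σ< n (λ j → Σ< m (λ i → f i j))
Σ<-swap zero    n f = sym (Σ<-zero n λ _ _ → refl)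
Σ<-swap (suc m) n f =
  trans (cong (_+_ _) (Σ<-swap m n (f ∘ suc))) (sym (Σ<-+ n (f 0) _))

-- Sums over antidiagonals and triangles.

antidiagonal : ℕ → (ℕ → ℕ → ℤ) → ℤ
antidiagonal zero    h = h 0 0
antidiagonal (suc k) h = h 0 (suc k) + antidiagonal k (h ∘ suc)

antidiagonal-cong : ∀ k {g h : ℕ → ℕ → ℤ} → (∀ r s → r ℕ.+ s ≡ k → g r s ≡ h r s) →
                    antidiagonal k g ≡ antidiagonal k h
antidiagonal-cong zero    eq = eq 0 0 refl
antidiagonal-cong (suc k) eq =
  cong₂ _+_ (eq 0 (suc k) refl) (antidiagonal-cong k λ r s r+s≡k → eq (suc r) s (cong suc r+s≡k))

antidiagonal-+ : ∀ k (g h : ℕ → ℕ → ℤ) →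
                 antidiagonal k (λ r s → g r s + h r s) ≡ antidiagonal k g + antidiagonal k h
antidiagonal-+ zero    g h = refl
antidiagonal-+ (suc k) g h =
  trans (cong (_+_ _) (antidiagonal-+ k (g ∘ suc) (h ∘ suc))) (interchange (g 0 (suc k)) _ _ _)

antidiagonal-0 : ∀ k → antidiagonal k (λ _ _ → 0ℤ) ≡ 0ℤ
antidiagonal-0 zero    = refl
antidiagonal-0 (suc k) = trans (+-identityˡ _) (antidiagonal-0 k)

antidiagonal-last : ∀ k (h : ℕ → ℕ → ℤ) →
  antidiagonal (suc k) h ≡ antidiagonal k (λ r s → h r (suc s)) + h (suc k) 0
antidiagonal-last zero    h = refl
antidiagonal-last (suc k) h =
  trans (cong (_+_ _) (antidiagonal-last k (h ∘ suc))) (sym (+-assoc (h 0 (suc (suc k))) _ _))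

antidiagonal-ends : ∀ k (h : ℕ → ℕ → ℤ) → antidiagonal (suc (suc k)) h ≡
  h 0 (suc (suc k)) + (antidiagonal k (λ r s → h (suc r) (suc s)) + h (suc (suc k)) 0)
antidiagonal-ends k h = cong (_+_ _) (antidiagonal-last k (h ∘ suc))

-- The sum over all `r + s < k`, sliced by `r`; this slicing compares well with a rectangle.
triangle : ℕ → (ℕ → ℕ → ℤ) → ℤ
triangle zero    h = 0ℤ
triangle (suc k) h = Σ< (suc k) (h 0) + triangle k (h ∘ suc)

-- This is the slicing by `r + s`: each row of the triangle grows by one term, and the new terms
-- form an antidiagonal. Non-negativity is known only for whole antidiagonals, hence the change of
-- slicing.
triangle-suc : ∀ k h → triangle (suc k) h ≡ triangle k h + antidiagonal k h
triangle-suc zero    h = trans (+-identityʳ _) (+-comm (h 0 0) 0ℤ)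
triangle-suc (suc k) h = begin
  Σ< (suc (suc k)) (h 0) + triangle (suc k) (h ∘ suc)
    ≡⟨ cong₂ _+_ (Σ<-last (suc k) (h 0)) (triangle-suc k (h ∘ suc)) ⟩
  (Σ< (suc k) (h 0) + h 0 (suc k)) + (triangle k (h ∘ suc) + antidiagonal k (h ∘ suc))
    ≡⟨ interchange (Σ< (suc k) (h 0)) _ _ _ ⟩
  triangle (suc k) h + antidiagonal (suc k) h ∎

triangle-nonneg : ∀ k h → (∀ t → 0ℤ ≤ antidiagonal t h) → 0ℤ ≤ triangle k h
triangle-nonneg zero    h pos = ℤ.≤-refl
triangle-nonneg (suc k) h pos =
  subst (0ℤ ≤_) (sym (triangle-suc k h)) (+-nonneg (triangle-nonneg k h pos) (pos k))

triangle-zero : ∀ k h → (∀ r s → h r s ≡ 0ℤ) → triangle k h ≡ 0ℤ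
triangle-zero zero    h eq = refl
triangle-zero (suc k) h eq =
  +-zero (Σ<-zero (suc k) λ i _ → eq 0 i) (triangle-zero k (h ∘ suc) (eq ∘ suc))

-- The cells with `r < R` and `s < S` satisfy `r + s < R + S`, so the triangle contains the
-- rectangle, and `h` vanishes on the rest of it.
triangle≡rectangle : ∀ R S (h : ℕ → ℕ → ℤ) →
  (∀ r s → R ℕ.≤ r → h r s ≡ 0ℤ) → (∀ r s → S ℕ.≤ s → h r s ≡ 0ℤ) →
  triangle (R ℕ.+ S) h ≡ Σ< R (λ r → Σ< S (h r))
triangle≡rectangle zero    S h r-van s-van = triangle-zero S h λ r s → r-van r s z≤n
triangle≡rectangle (suc R) S h r-van s-van =
  cong₂ _+_ row (triangle≡rectangle R S (h ∘ suc) (λ r s → r-van (suc r) s ∘ s≤s) (s-van ∘ suc))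
  where
  row : Σ< (suc R ℕ.+ S) (h 0) ≡ Σ< S (h 0)
  row = begin
    Σ< (suc R ℕ.+ S) (h 0)                             ≡⟨ cong (λ k → Σ< k (h 0)) (ℕ.+-comm (suc R) S) ⟩
    Σ< (S ℕ.+ suc R) (h 0)                             ≡⟨ Σ<-split S (suc R) (h 0) ⟩
    Σ< S (h 0) + Σ< (suc R) (λ i → h 0 (S ℕ.+ i))      ≡⟨ cong (_+_ _) (Σ<-zero (suc R) λ i _ → s-van 0 _ (ℕ.m≤m+n S i)) ⟩
    Σ< S (h 0) + 0ℤ                                    ≡⟨ +-identityʳ _ ⟩
    Σ< S (h 0)                                         ∎

-- Power series and multiplication by powers of q.

-- shift d f is q ^ d f.
shift : ℕ → Series → Series
shift zero    f n       = f n
shift (suc d) f zero    = 0ℤ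
shift (suc d) f (suc n) = shift d f n

-- Multiplication by a power of q never looks at higher coefficients. This locality matters later,
-- when two series agree only up to `n`.
shift-cong≤ : ∀ d {f g} n → (∀ k → k ℕ.≤ n → f k ≡ g k) → shift d f n ≡ shift d g n
shift-cong≤ zero    n       eq = eq n ℕ.≤-refl
shift-cong≤ (suc d) zero    eq = refl
shift-cong≤ (suc d) (suc n) eq = shift-cong≤ d n λ k → eq k ∘ ℕ.m≤n⇒m≤1+n

shift-cong : ∀ d {f g} → f ≗ g → shift d f ≗ shift d g
shift-cong d eq n = shift-cong≤ d n λ k _ → eq k

shift-∘ : ∀ c d f → shift (c ℕ.+ d) f ≗ shift c (shift d f)
shift-∘ zero    d f n       = refl
shift-∘ (suc c) d f zero    = refl
shift-∘ (suc c) d f (suc n) = shift-∘ c d f n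

shift-merge : ∀ c d {e} f → c ℕ.+ d ≡ e → shift c (shift d f) ≗ shift e f
shift-merge c d f refl n = sym (shift-∘ c d f n)

shift-+ : ∀ d f g n → shift d (λ i → f i + g i) n ≡ shift d f n + shift d g n
shift-+ zero    f g n       = refl
shift-+ (suc d) f g zero    = sym (+-identityˡ 0ℤ)
shift-+ (suc d) f g (suc n) = shift-+ d f g n

shift-*ˡ : ∀ d c f n → shift d (λ i → c * f i) n ≡ c * shift d f n
shift-*ˡ zero    c f n       = refl
shift-*ˡ (suc d) c f zero    = sym (zeroʳ c)
shift-*ˡ (suc d) c f (suc n) = shift-*ˡ d c f n

shift-vanish : ∀ d b {f} n → (∀ k → k ℕ.< b → f k ≡ 0ℤ) → n ℕ.< d ℕ.+ b → shift d f n ≡ 0ℤ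
shift-vanish zero    b n       eq n<     = eq n n<
shift-vanish (suc d) b zero    eq n<     = refl
shift-vanish (suc d) b (suc n) eq (s≤s n<) = shift-vanish d b n eq n<

shift-antidiagonal : ∀ d k (h : ℕ → ℕ → Series) n →
  shift d (λ i → antidiagonal k (λ r s → h r s i)) n ≡ antidiagonal k (λ r s → shift d (h r s) n)
shift-antidiagonal zero    k h n       = refl
shift-antidiagonal (suc d) k h zero    = sym (antidiagonal-0 k)
shift-antidiagonal (suc d) k h (suc n) = shift-antidiagonal d k h n

NonNegative : Series → Set
NonNegative f = ∀ n → 0ℤ ≤ f n

shift-nonneg≤ : ∀ d {f} n → (∀ k → k ℕ.≤ n → 0ℤ ≤ f k) → 0ℤ ≤ shift d f n
shift-nonneg≤ zero    n       pos = pos n ℕ.≤-refl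
shift-nonneg≤ (suc d) zero    pos = ℤ.≤-refl
shift-nonneg≤ (suc d) (suc n) pos = shift-nonneg≤ d n λ k → pos k ∘ ℕ.m≤n⇒m≤1+n

shift-nonneg : ∀ d {f} → NonNegative f → NonNegative (shift d f)
shift-nonneg d pos n = shift-nonneg≤ d n λ k _ → pos k

-- f = q ^ d f + g means f = g / (1 - q ^ d).
geometric-nonneg : ∀ d .{{_ : NonZero d}} {f g} → (∀ n → f n ≡ shift d f n + g n) →
                   NonNegative g → NonNegative f
geometric-nonneg (suc d) {f} {g} eq pos n = below n n ℕ.≤-refl
  where
  below : ∀ b n → n ℕ.≤ b → 0ℤ ≤ f n
  below b       zero    _         = subst (0ℤ ≤_) (sym (eq 0)) (+-nonneg ℤ.≤-refl (pos 0))
  -- The bound `b` makes strong induction structural. As the exponent is positive, coefficient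
  -- `suc n` of the shifted series uses only coefficients of `f` up to `n`.
  below (suc b) (suc n) (s≤s n≤b) =
    subst (0ℤ ≤_) (sym (eq (suc n)))
      (+-nonneg (shift-nonneg≤ d n λ k k≤n → below b k (ℕ.≤-trans k≤n n≤b)) (pos (suc n)))

-- The Cauchy product.

-- For `i` at most `n`, `shift i g n` is the coefficient of `g` at `n - i`; writing it as a shift
-- avoids subtraction.
_⊛_ : Series → Series → Series
(f ⊛ g) n = Σ< (suc n) (λ i → f i * shift i g n)

⊛-congˡ : ∀ {f f′} g → f ≗ f′ → f ⊛ g ≗ f′ ⊛ g
⊛-congˡ g eq n = Σ<-cong (suc n) λ i _ → cong (_* shift i g n) (eq i)

⊛-congʳ : ∀ f {g g′} → g ≗ g′ → f ⊛ g ≗ f ⊛ g′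
⊛-congʳ f eq n = Σ<-cong (suc n) λ i _ → cong (f i *_) (shift-cong i eq n)

⊛-distribʳ : ∀ f f′ g n → ((λ i → f i + f′ i) ⊛ g) n ≡ (f ⊛ g) n + (f′ ⊛ g) n
⊛-distribʳ f f′ g n =
  trans (Σ<-cong (suc n) λ i _ → distribʳ (shift i g n) (f i) (f′ i))
        (Σ<-+ (suc n) (λ i → f i * shift i g n) (λ i → f′ i * shift i g n))

⊛-distribˡ : ∀ f g g′ n → (f ⊛ (λ i → g i + g′ i)) n ≡ (f ⊛ g) n + (f ⊛ g′) n
⊛-distribˡ f g g′ n =
  trans (Σ<-cong (suc n) λ i _ → trans (cong (f i *_) (shift-+ i g g′ n)) (distribˡ (f i) _ _))
        (Σ<-+ (suc n) (λ i → f i * shift i g n) (λ i → f i * shift i g′ n))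

⊛-shiftˡ : ∀ d f g → shift d f ⊛ g ≗ shift d (f ⊛ g)
⊛-shiftˡ zero    f g n       = refl
⊛-shiftˡ (suc d) f g zero    = +-zero (zeroˡ (g 0)) refl
⊛-shiftˡ (suc d) f g (suc n) =
  trans (cong₂ _+_ (zeroˡ (g (suc n))) refl)
        (trans (+-identityˡ _) (⊛-shiftˡ d f g n))

-- The left sum has one more term than the right, with index `suc n`; it contains the constant
-- coefficient of a positive shift and is zero.
⊛-shift1ʳ : ∀ d f g n → (f ⊛ shift (suc d) g) (suc n) ≡ (f ⊛ shift d g) n
⊛-shift1ʳ d f g zero    = cong (_+_ _) (+-zero (zeroʳ (f 1)) refl)
⊛-shift1ʳ d f g (suc n) = cong (_+_ _) (⊛-shift1ʳ d (f ∘ suc) g n)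

⊛-shiftʳ : ∀ d f g → f ⊛ shift d g ≗ shift d (f ⊛ g)
⊛-shiftʳ zero    f g n       = refl
⊛-shiftʳ (suc d) f g zero    = +-zero (zeroʳ (f 0)) refl
⊛-shiftʳ (suc d) f g (suc n) = trans (⊛-shift1ʳ d f g n) (⊛-shiftʳ d f g n)

⊛-nonneg : ∀ {f g} → NonNegative f → NonNegative g → NonNegative (f ⊛ g)
⊛-nonneg {f} {g} f≥0 g≥0 n = go (suc n) λ i → *-nonneg (f≥0 i) (shift-nonneg i g≥0 n)
  where
  go : ∀ k {h} → (∀ i → 0ℤ ≤ h i) → 0ℤ ≤ Σ< k h
  go zero    pos = ℤ.≤-refl
  go (suc k) pos = +-nonneg (pos 0) (go k (pos ∘ suc))

-- Functional equations and the recurrence along antidiagonals.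

module Antidiagonals (a m : ℕ) .{{_ : NonZero m}} (u v : ℕ → Series)
  -- In the application `u r` is (-1) ^ r p r and `v s` is p s. Both hypotheses are then the
  -- functional equation of p; the sign moves the z-term of the first to the other side.
  (u-suc : ∀ r n → u (suc r) n + shift a (u r) n ≡ shift (m ℕ.* suc r) (u (suc r)) n)
  (v-suc : ∀ s n → v (suc s) n ≡ shift a (v s) n + shift (m ℕ.* suc s) (v (suc s)) n)
  (u₀-nonneg : NonNegative (u 0)) (v₀-nonneg : NonNegative (v 0))
  where

  -- The exponent is the size of ρ, bracketed as in `copartitionSize`.
  B : ℕ → ℕ → Series
  B r s = u r ⊛ shift (s ℕ.* (m ℕ.* r)) (v s)

  B≗ : ∀ r s → B r s ≗ shift (s ℕ.* (m ℕ.* r)) (u r ⊛ v s)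
  B≗ r s = ⊛-shiftʳ (s ℕ.* (m ℕ.* r)) (u r) (v s)

  -- Multiply `u-suc` by Q ^ ((r + 1) s) v s. In the z-term this power exceeds the one in `B r s` by
  -- Q ^ s.
  B-sucˡ : ∀ r s n → B (suc r) s n + shift (a ℕ.+ m ℕ.* s) (B r s) n ≡ shift (m ℕ.* suc r) (B (suc r) s) n
  B-sucˡ r s n = begin
    B (suc r) s n + shift (a ℕ.+ m ℕ.* s) (B r s) n
      ≡⟨ cong (_+_ _) (trans (shift-cong (a ℕ.+ m ℕ.* s) (B≗ r s) n)
           (trans (shift-merge (a ℕ.+ m ℕ.* s) (s ℕ.* (m ℕ.* r)) (u r ⊛ v s) (exponent a m r s) n) (shift-∘ a c (u r ⊛ v s) n))) ⟩
    B (suc r) s n + shift a (shift c (u r ⊛ v s)) n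
      ≡⟨ cong (_+_ _) (trans (shift-cong a (λ k → sym (⊛-shiftʳ c (u r) (v s) k)) n)
                             (sym (⊛-shiftˡ a (u r) g n))) ⟩
    (u (suc r) ⊛ g) n + (shift a (u r) ⊛ g) n
      ≡⟨ ⊛-distribʳ (u (suc r)) (shift a (u r)) g n ⟨
    ((λ i → u (suc r) i + shift a (u r) i) ⊛ g) n
      ≡⟨ ⊛-congˡ g (u-suc r) n ⟩
    (shift (m ℕ.* suc r) (u (suc r)) ⊛ g) n
      ≡⟨ ⊛-shiftˡ (m ℕ.* suc r) (u (suc r)) g n ⟩
    shift (m ℕ.* suc r) (B (suc r) s) n ∎
    where
    c = s ℕ.* (m ℕ.* suc r)
    g = shift c (v s)
    exponent : ∀ a m r s → a ℕ.+ m ℕ.* s ℕ.+ s ℕ.* (m ℕ.* r) ≡ a ℕ.+ s ℕ.* (m ℕ.* suc r)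
    exponent = ℕRing.solve-∀

  -- The mirror image: `v-suc` is multiplied by Q ^ (r (s + 1)) u r, and the surplus is Q ^ r.
  B-sucʳ : ∀ r s n → B r (suc s) n ≡ shift (a ℕ.+ m ℕ.* r) (B r s) n + shift (m ℕ.* suc s) (B r (suc s)) n
  B-sucʳ r s n = begin
    B r (suc s) n
      ≡⟨ B≗ r (suc s) n ⟩
    shift c (u r ⊛ v (suc s)) n
      ≡⟨ shift-cong c (λ k → trans (⊛-congʳ (u r) (v-suc s) k) (⊛-distribˡ (u r) (shift a (v s)) _ k)) n ⟩
    shift c (λ k → (u r ⊛ shift a (v s)) k + (u r ⊛ shift e (v (suc s))) k) n
      ≡⟨ shift-+ c (u r ⊛ shift a (v s)) (u r ⊛ shift e (v (suc s))) n ⟩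
    shift c (u r ⊛ shift a (v s)) n + shift c (u r ⊛ shift e (v (suc s))) n
      ≡⟨ cong₂ _+_ left right ⟩
    shift (a ℕ.+ m ℕ.* r) (B r s) n + shift e (B r (suc s)) n ∎
    where
    c = suc s ℕ.* (m ℕ.* r)
    e = m ℕ.* suc s
    exponent : ∀ a m r s → suc s ℕ.* (m ℕ.* r) ℕ.+ a ≡ a ℕ.+ m ℕ.* r ℕ.+ s ℕ.* (m ℕ.* r)
    exponent = ℕRing.solve-∀
    left : shift c (u r ⊛ shift a (v s)) n ≡ shift (a ℕ.+ m ℕ.* r) (B r s) n
    left = begin
      shift c (u r ⊛ shift a (v s)) n             ≡⟨ shift-cong c (⊛-shiftʳ a (u r) (v s)) n ⟩
      shift c (shift a (u r ⊛ v s)) n             ≡⟨ shift-merge c a (u r ⊛ v s) (exponent a m r s) n ⟩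
      shift (a ℕ.+ m ℕ.* r ℕ.+ s ℕ.* (m ℕ.* r)) (u r ⊛ v s) n
        ≡⟨ shift-∘ (a ℕ.+ m ℕ.* r) _ (u r ⊛ v s) n ⟩
      shift (a ℕ.+ m ℕ.* r) (shift (s ℕ.* (m ℕ.* r)) (u r ⊛ v s)) n
        ≡⟨ shift-cong (a ℕ.+ m ℕ.* r) (λ k → sym (B≗ r s k)) n ⟩
      shift (a ℕ.+ m ℕ.* r) (B r s) n ∎
    right : shift c (u r ⊛ shift e (v (suc s))) n ≡ shift e (B r (suc s)) n
    right = begin
      shift c (u r ⊛ shift e (v (suc s))) n       ≡⟨ shift-cong c (⊛-shiftʳ e (u r) (v (suc s))) n ⟩
      shift c (shift e (u r ⊛ v (suc s))) n       ≡⟨ shift-merge c e (u r ⊛ v (suc s)) (ℕ.+-comm c e) n ⟩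
      shift (e ℕ.+ c) (u r ⊛ v (suc s)) n         ≡⟨ shift-∘ e c (u r ⊛ v (suc s)) n ⟩
      shift e (shift c (u r ⊛ v (suc s))) n       ≡⟨ shift-cong e (λ k → sym (B≗ r (suc s) k)) n ⟩
      shift e (B r (suc s)) n                     ∎

  shift-B-sucˡ : ∀ d r s n → shift d (B (suc r) s) n + shift (d ℕ.+ (a ℕ.+ m ℕ.* s)) (B r s) n
                           ≡ shift (d ℕ.+ m ℕ.* suc r) (B (suc r) s) n
  shift-B-sucˡ d r s n = begin
    shift d (B (suc r) s) n + shift (d ℕ.+ (a ℕ.+ m ℕ.* s)) (B r s) n
      ≡⟨ cong (_+_ _) (shift-∘ d _ (B r s) n) ⟩
    shift d (B (suc r) s) n + shift d (shift (a ℕ.+ m ℕ.* s) (B r s)) n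
      ≡⟨ shift-+ d (B (suc r) s) _ n ⟨
    shift d (λ k → B (suc r) s k + shift (a ℕ.+ m ℕ.* s) (B r s) k) n
      ≡⟨ shift-cong d (B-sucˡ r s) n ⟩
    shift d (shift (m ℕ.* suc r) (B (suc r) s)) n
      ≡⟨ shift-∘ d _ (B (suc r) s) n ⟨
    shift (d ℕ.+ m ℕ.* suc r) (B (suc r) s) n ∎

  shift-B-sucʳ : ∀ d r s n → shift d (B r (suc s)) n
    ≡ shift (d ℕ.+ (a ℕ.+ m ℕ.* r)) (B r s) n + shift (d ℕ.+ m ℕ.* suc s) (B r (suc s)) n
  shift-B-sucʳ d r s n = begin
    shift d (B r (suc s)) n
      ≡⟨ shift-cong d (B-sucʳ r s) n ⟩
    shift d (λ k → shift (a ℕ.+ m ℕ.* r) (B r s) k + shift (m ℕ.* suc s) (B r (suc s)) k) n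
      ≡⟨ shift-+ d (shift (a ℕ.+ m ℕ.* r) (B r s)) _ n ⟩
    shift d (shift (a ℕ.+ m ℕ.* r) (B r s)) n + shift d (shift (m ℕ.* suc s) (B r (suc s))) n
      ≡⟨ cong₂ _+_ (shift-∘ d _ (B r s) n) (shift-∘ d _ (B r (suc s)) n) ⟨
    shift (d ℕ.+ (a ℕ.+ m ℕ.* r)) (B r s) n + shift (d ℕ.+ m ℕ.* suc s) (B r (suc s)) n ∎

  D E : ℕ → Series
  D k n = antidiagonal k (λ r s → B r s n)
  E k n = antidiagonal k (λ r s → shift (m ℕ.* r) (B r s) n)

  -- `E` at the preceding index, with value 0 before the start, so that `D-E` and `E-V` have one
  -- form for all `k`.
  E⁻ : ℕ → Series
  E⁻ zero    n = 0ℤ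
  E⁻ (suc k) = E k

  -- The difference E k - z E (k - 1) written through `D` as Q ^ k D k + z ^ 2 Q ^ (k - 1) D (k -
  -- 2), where `D` at a negative index counts as 0. In this form its non-negativity follows from
  -- that of `D`.
  V : ℕ → Series
  V zero          = D 0
  V (suc zero)    = shift (m ℕ.* 1) (D 1)
  V (suc (suc k)) n = shift (m ℕ.* suc (suc k)) (D (suc (suc k))) n
                    + shift (a ℕ.+ a ℕ.+ m ℕ.* suc k) (D k) n

  shift-m*0 : ∀ f → shift (m ℕ.* 0) f ≗ f
  shift-m*0 f n rewrite ℕ.*-zeroʳ m = refl

  B-sucˡ-0 : ∀ r n → B (suc r) 0 n + shift a (B r 0) n ≡ shift (m ℕ.* suc r) (B (suc r) 0) n
  B-sucˡ-0 r n = subst (λ d → B (suc r) 0 n + shift d (B r 0) n ≡ shift (m ℕ.* suc r) (B (suc r) 0) n)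
    (trans (cong (a ℕ.+_) (ℕ.*-zeroʳ m)) (ℕ.+-identityʳ a)) (B-sucˡ r 0 n)

  B-sucʳ-0 : ∀ s n → B 0 (suc s) n ≡ shift a (B 0 s) n + shift (m ℕ.* suc s) (B 0 (suc s)) n
  B-sucʳ-0 s n = subst (λ d → B 0 (suc s) n ≡ shift d (B 0 s) n + shift (m ℕ.* suc s) (B 0 (suc s)) n)
    (trans (cong (a ℕ.+_) (ℕ.*-zeroʳ m)) (ℕ.+-identityʳ a)) (B-sucʳ 0 s n)

  -- `B-sucʳ` splits z B r (s + 1) into z ^ 2 Q ^ r B r s and z Q ^ (s + 1) B r (s + 1); `B-sucˡ`
  -- absorbs the latter together with B (r + 1) (s + 1).
  D-E-cell : ∀ r s n → B (suc r) (suc s) n + shift a (B r (suc s)) n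
    ≡ shift (m ℕ.* suc r) (B (suc r) (suc s)) n + shift (a ℕ.+ a) (shift (m ℕ.* r) (B r s)) n
  D-E-cell r s n = begin
    B (suc r) (suc s) n + shift a (B r (suc s)) n
      ≡⟨ cong (_+_ _) (shift-B-sucʳ a r s n) ⟩
    B (suc r) (suc s) n + (shift (a ℕ.+ (a ℕ.+ m ℕ.* r)) (B r s) n + shift (a ℕ.+ m ℕ.* suc s) (B r (suc s)) n)
      ≡⟨ rearrange (B (suc r) (suc s) n) _ _ ⟩
    (B (suc r) (suc s) n + shift (a ℕ.+ m ℕ.* suc s) (B r (suc s)) n) + shift (a ℕ.+ (a ℕ.+ m ℕ.* r)) (B r s) n
      ≡⟨ cong₂ _+_ (B-sucˡ r (suc s) n) (sym (shift-merge (a ℕ.+ a) (m ℕ.* r) (B r s) (ℕ.+-assoc a a (m ℕ.* r)) n)) ⟩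
    shift (m ℕ.* suc r) (B (suc r) (suc s)) n + shift (a ℕ.+ a) (shift (m ℕ.* r) (B r s)) n ∎
    where
    rearrange : ∀ x y z → x + (y + z) ≡ (x + z) + y
    rearrange =
      solve 3 (λ x y z → x ⊕ (y ⊕ z) ⊜ (x ⊕ z) ⊕ y) refl

  -- Apply `B-sucʳ`, then `B-sucˡ` backwards to the z-term. The exponents of Q on the last two terms
  -- add up to multiples of r + s + 2 and r + s + 1, so they are constant along an antidiagonal and
  -- these terms sum to multiples of `D`.
  E-D-cell : ∀ k r s n → r ℕ.+ s ≡ k → shift (m ℕ.* suc r) (B (suc r) (suc s)) n
    ≡ shift a (shift (m ℕ.* suc r) (B (suc r) s)) n
      + (shift (m ℕ.* suc (suc k)) (B (suc r) (suc s)) n + shift (a ℕ.+ a ℕ.+ m ℕ.* suc k) (B r s) n)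
  E-D-cell k r s n refl = begin
    shift (m ℕ.* suc r) (B (suc r) (suc s)) n
      ≡⟨ shift-B-sucʳ (m ℕ.* suc r) (suc r) s n ⟩
    shift (m ℕ.* suc r ℕ.+ (a ℕ.+ m ℕ.* suc r)) (B (suc r) s) n + shift (m ℕ.* suc r ℕ.+ m ℕ.* suc s) (B (suc r) (suc s)) n
      ≡⟨ cong₂ (λ c d → shift c (B (suc r) s) n + shift d (B (suc r) (suc s)) n) (ℕ.+-comm (m ℕ.* suc r) _) (exp₁ m r s) ⟩
    shift (a ℕ.+ m ℕ.* suc r ℕ.+ m ℕ.* suc r) (B (suc r) s) n + x
      ≡⟨ cong (_+ x) (shift-B-sucˡ (a ℕ.+ m ℕ.* suc r) r s n) ⟨
    (shift (a ℕ.+ m ℕ.* suc r) (B (suc r) s) n + shift (a ℕ.+ m ℕ.* suc r ℕ.+ (a ℕ.+ m ℕ.* s)) (B r s) n) + x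
      ≡⟨ cong₂ (λ y d → (y + shift d (B r s) n) + x) (shift-∘ a _ (B (suc r) s) n) (exp₂ a m r s) ⟩
    (shift a (shift (m ℕ.* suc r) (B (suc r) s)) n + shift (a ℕ.+ a ℕ.+ m ℕ.* suc k) (B r s) n) + x
      ≡⟨ rearrange _ _ x ⟩
    shift a (shift (m ℕ.* suc r) (B (suc r) s)) n + (x + shift (a ℕ.+ a ℕ.+ m ℕ.* suc k) (B r s) n) ∎
    where
    x = shift (m ℕ.* suc (suc k)) (B (suc r) (suc s)) n
    exp₁ : ∀ m r s → m ℕ.* suc r ℕ.+ m ℕ.* suc s ≡ m ℕ.* suc (suc (r ℕ.+ s))
    exp₁ = ℕRing.solve-∀
    exp₂ : ∀ a m r s → a ℕ.+ m ℕ.* suc r ℕ.+ (a ℕ.+ m ℕ.* s) ≡ a ℕ.+ a ℕ.+ m ℕ.* suc (r ℕ.+ s)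
    exp₂ = ℕRing.solve-∀
    rearrange : ∀ x y z → (x + y) + z ≡ x + (z + y)
    rearrange =
      solve 3 (λ x y z → (x ⊕ y) ⊕ z ⊜ x ⊕ (z ⊕ y)) refl

  -- Sum `D-E-cell` over the inner cells. The cell with `r = 0` is common to both sides, since Q ^ 0
  -- = 1, and the cell with `s = 0` is `B-sucˡ-0`.
  D-E : ∀ k n → D (suc k) n + shift a (D k) n ≡ E (suc k) n + shift (a ℕ.+ a) (E⁻ k) n
  D-E zero n = begin
    (B 0 1 n + B 1 0 n) + shift a (B 0 0) n
      ≡⟨ +-assoc (B 0 1 n) _ _ ⟩
    B 0 1 n + (B 1 0 n + shift a (B 0 0) n)
      ≡⟨ cong₂ _+_ (sym (shift-m*0 (B 0 1) n)) (B-sucˡ-0 0 n) ⟩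
    E 1 n
      ≡⟨ +-identityʳ _ ⟨
    E 1 n + 0ℤ
      ≡⟨ cong (_+_ _) (shift-vanish (a ℕ.+ a) (suc n) n (λ _ _ → refl) (ℕ.m≤n+m (suc n) (a ℕ.+ a))) ⟨
    E 1 n + shift (a ℕ.+ a) (E⁻ 0) n ∎
  D-E (suc k) n = begin
    D (suc (suc k)) n + shift a (D (suc k)) n
      ≡⟨ cong₂ _+_ (antidiagonal-ends k (λ r s → B r s n))
           (trans (shift-antidiagonal a (suc k) B n) (antidiagonal-last k (λ r s → shift a (B r s) n))) ⟩
    (B 0 (suc (suc k)) n + (antidiagonal k b₁ + B (suc (suc k)) 0 n)) + (antidiagonal k b₂ + shift a (B (suc k) 0) n)
      ≡⟨ gather (B 0 (suc (suc k)) n) _ _ _ _ ⟩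
    B 0 (suc (suc k)) n + ((antidiagonal k b₁ + antidiagonal k b₂) + (B (suc (suc k)) 0 n + shift a (B (suc k) 0) n))
      ≡⟨ cong₂ _+_ (sym (shift-m*0 (B 0 (suc (suc k))) n)) (cong₂ _+_ middle (B-sucˡ-0 (suc k) n)) ⟩
    e₀ + ((antidiagonal k c₁ + antidiagonal k c₂) + eₖ)
      ≡⟨ spread e₀ _ _ eₖ ⟩
    (e₀ + (antidiagonal k c₁ + eₖ)) + antidiagonal k c₂
      ≡⟨ cong₂ _+_ (antidiagonal-ends k (λ r s → shift (m ℕ.* r) (B r s) n))
                   (shift-antidiagonal (a ℕ.+ a) k (λ r s → shift (m ℕ.* r) (B r s)) n) ⟨
    E (suc (suc k)) n + shift (a ℕ.+ a) (E k) n ∎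
    where
    b₁ b₂ c₁ c₂ : ℕ → ℕ → ℤ
    b₁ r s = B (suc r) (suc s) n
    b₂ r s = shift a (B r (suc s)) n
    c₁ r s = shift (m ℕ.* suc r) (B (suc r) (suc s)) n
    c₂ r s = shift (a ℕ.+ a) (shift (m ℕ.* r) (B r s)) n
    e₀ = shift (m ℕ.* 0) (B 0 (suc (suc k))) n
    eₖ = shift (m ℕ.* suc (suc k)) (B (suc (suc k)) 0) n
    middle : antidiagonal k b₁ + antidiagonal k b₂ ≡ antidiagonal k c₁ + antidiagonal k c₂
    middle = trans (sym (antidiagonal-+ k b₁ b₂))
               (trans (antidiagonal-cong k λ r s _ → D-E-cell r s n) (antidiagonal-+ k c₁ c₂))
    gather : ∀ v w x y z → (v + (w + x)) + (y + z) ≡ v + ((w + y) + (x + z))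
    gather =
      solve 5 (λ v w x y z → (v ⊕ (w ⊕ x)) ⊕ (y ⊕ z) ⊜ v ⊕ ((w ⊕ y) ⊕ (x ⊕ z))) refl
    spread : ∀ w x y z → w + ((x + y) + z) ≡ (w + (x + z)) + y
    spread =
      solve 4 (λ w x y z → w ⊕ ((x ⊕ y) ⊕ z) ⊜ (w ⊕ (x ⊕ z)) ⊕ y) refl

  -- Sum `E-D-cell` over the inner cells. The cell with `r = 0` is split by `B-sucʳ-0`; the cell
  -- with `s = 0` already carries the power of Q that `V` needs.
  E-V : ∀ k n → E k n ≡ shift a (E⁻ k) n + V k n
  E-V zero n = begin
    E 0 n                       ≡⟨ shift-m*0 (B 0 0) n ⟩
    D 0 n                       ≡⟨ +-identityˡ _ ⟨
    0ℤ + D 0 n                  ≡⟨ cong (_+ D 0 n) (shift-vanish a (suc n) n (λ _ _ → refl) (ℕ.m≤n+m (suc n) a)) ⟨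
    shift a (E⁻ 0) n + D 0 n    ∎
  E-V (suc zero) n = begin
    shift (m ℕ.* 0) (B 0 1) n + shift (m ℕ.* 1) (B 1 0) n
      ≡⟨ cong₂ _+_ (trans (shift-m*0 (B 0 1) n) (B-sucʳ-0 0 n)) refl ⟩
    (shift a (B 0 0) n + shift (m ℕ.* 1) (B 0 1) n) + shift (m ℕ.* 1) (B 1 0) n
      ≡⟨ +-assoc (shift a (B 0 0) n) _ _ ⟩
    shift a (B 0 0) n + (shift (m ℕ.* 1) (B 0 1) n + shift (m ℕ.* 1) (B 1 0) n)
      ≡⟨ cong₂ _+_ (shift-cong a (λ i → shift-m*0 (B 0 0) i) n) (shift-+ (m ℕ.* 1) (B 0 1) (B 1 0) n) ⟨
    shift a (E 0) n + V 1 n ∎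
  E-V (suc (suc k)) n = begin
    E (suc (suc k)) n
      ≡⟨ antidiagonal-ends k (λ r s → shift (m ℕ.* r) (B r s) n) ⟩
    shift (m ℕ.* 0) (B 0 (suc (suc k))) n + (antidiagonal k c₁ + eₖ)
      ≡⟨ cong₂ _+_ first (cong (_+ eₖ) middle) ⟩
    (x₀ + d₀) + ((antidiagonal k x₁ + (antidiagonal k d₁ + antidiagonal k w)) + eₖ)
      ≡⟨ gather x₀ d₀ _ _ _ eₖ ⟩
    (x₀ + antidiagonal k x₁) + ((d₀ + (antidiagonal k d₁ + eₖ)) + antidiagonal k w)
      ≡⟨ cong₂ _+_ (shift-antidiagonal a (suc k) (λ r s → shift (m ℕ.* r) (B r s)) n)
          (cong₂ _+_ (trans (shift-antidiagonal q (suc (suc k)) B n) (antidiagonal-ends k (λ r s → shift q (B r s) n)))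
                     (shift-antidiagonal p k B n)) ⟨
    shift a (E (suc k)) n + V (suc (suc k)) n ∎
    where
    q = m ℕ.* suc (suc k)
    p = a ℕ.+ a ℕ.+ m ℕ.* suc k
    c₁ x₁ d₁ w : ℕ → ℕ → ℤ
    c₁ r s = shift (m ℕ.* suc r) (B (suc r) (suc s)) n
    x₁ r s = shift a (shift (m ℕ.* suc r) (B (suc r) s)) n
    d₁ r s = shift q (B (suc r) (suc s)) n
    w  r s = shift p (B r s) n
    x₀ = shift a (shift (m ℕ.* 0) (B 0 (suc k))) n
    d₀ = shift q (B 0 (suc (suc k))) n
    eₖ = shift q (B (suc (suc k)) 0) n
    first : shift (m ℕ.* 0) (B 0 (suc (suc k))) n ≡ x₀ + d₀
    first = trans (shift-m*0 (B 0 (suc (suc k))) n) (trans (B-sucʳ-0 (suc k) n)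
              (cong (_+ d₀) (shift-cong a (λ i → sym (shift-m*0 (B 0 (suc k)) i)) n)))
    middle : antidiagonal k c₁ ≡ antidiagonal k x₁ + (antidiagonal k d₁ + antidiagonal k w)
    middle = trans (antidiagonal-cong k λ r s → E-D-cell k r s n)
               (trans (antidiagonal-+ k x₁ (λ r s → d₁ r s + w r s)) (cong (_+_ _) (antidiagonal-+ k d₁ w)))
    gather : ∀ u v w x y z → (u + v) + ((w + (x + y)) + z) ≡ (u + w) + ((v + (x + z)) + y)
    gather =
      solve 6 (λ u v w x y z → (u ⊕ v) ⊕ ((w ⊕ (x ⊕ y)) ⊕ z) ⊜ (u ⊕ w) ⊕ ((v ⊕ (x ⊕ z)) ⊕ y)) refl

  -- Take `D-E` at `suc k` and `E-V` at `k + 2`, and subtract z times `D-E` at `k`; with z ^ 2 times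
  -- `E-V` at `k` every `E` and also D (k + 1) cancels. All signs that remain are positive.
  D-rec : ∀ k n → D (suc (suc k)) n ≡ shift (m ℕ.* suc (suc k)) (D (suc (suc k))) n
    + ((shift (a ℕ.+ a ℕ.+ m ℕ.* suc k) (D k) n + shift (a ℕ.+ a) (D k) n) + shift (a ℕ.+ a) (V k) n)
  D-rec k n = eliminate _ _ _ _ _ _ _ _ _ _ (D-E (suc k) n) (E-V (suc (suc k)) n) shifted-D-E shifted-E-V
    where
    shifted-D-E : shift a (D (suc k)) n + shift (a ℕ.+ a) (D k) n
                ≡ shift a (E (suc k)) n + shift (a ℕ.+ a ℕ.+ a) (E⁻ k) n
    shifted-D-E = begin
      shift a (D (suc k)) n + shift (a ℕ.+ a) (D k) n
        ≡⟨ cong (_+_ _) (shift-∘ a a (D k) n) ⟩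
      shift a (D (suc k)) n + shift a (shift a (D k)) n
        ≡⟨ shift-+ a (D (suc k)) _ n ⟨
      shift a (λ i → D (suc k) i + shift a (D k) i) n
        ≡⟨ shift-cong a (D-E k) n ⟩
      shift a (λ i → E (suc k) i + shift (a ℕ.+ a) (E⁻ k) i) n
        ≡⟨ shift-+ a (E (suc k)) _ n ⟩
      shift a (E (suc k)) n + shift a (shift (a ℕ.+ a) (E⁻ k)) n
        ≡⟨ cong (_+_ _) (shift-merge a (a ℕ.+ a) (E⁻ k) (sym (ℕ.+-assoc a a a)) n) ⟩
      shift a (E (suc k)) n + shift (a ℕ.+ a ℕ.+ a) (E⁻ k) n ∎
    shifted-E-V : shift (a ℕ.+ a) (E k) n ≡ shift (a ℕ.+ a ℕ.+ a) (E⁻ k) n + shift (a ℕ.+ a) (V k) n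
    shifted-E-V = trans (shift-cong (a ℕ.+ a) (E-V k) n)
      (trans (shift-+ (a ℕ.+ a) (shift a (E⁻ k)) (V k) n) (cong₂ _+_ (sym (shift-∘ (a ℕ.+ a) a (E⁻ k) n)) refl))
    eliminate : ∀ d₂ d₁ d₀ e₂ e₁ e₀ e₋ q p v → d₂ + d₁ ≡ e₂ + e₀ → e₂ ≡ e₁ + (q + p) →
                d₁ + d₀ ≡ e₁ + e₋ → e₀ ≡ e₋ + v → d₂ ≡ q + ((p + d₀) + v)
    -- Adding `d₁ + d₀` to both sides lets `h₁` and `h₃` be used without subtraction.
    eliminate d₂ d₁ d₀ e₂ e₁ e₀ e₋ q p v h₁ refl h₃ refl = +-cancelʳ (d₁ + d₀) _ _ (begin
      d₂ + (d₁ + d₀)                              ≡⟨ +-assoc d₂ d₁ d₀ ⟨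
      (d₂ + d₁) + d₀                              ≡⟨ cong (_+ d₀) h₁ ⟩
      ((e₁ + (q + p)) + (e₋ + v)) + d₀            ≡⟨ rearrange e₁ q p e₋ v d₀ ⟩
      (q + ((p + d₀) + v)) + (e₁ + e₋)            ≡⟨ cong (_+_ _) h₃ ⟨
      (q + ((p + d₀) + v)) + (d₁ + d₀)            ∎)
      where
      rearrange : ∀ e₁ q p e₋ v d₀ →
        ((e₁ + (q + p)) + (e₋ + v)) + d₀ ≡ (q + ((p + d₀) + v)) + (e₁ + e₋)
      rearrange =
        solve 6 (λ e₁ q p e₋ v d₀ → ((e₁ ⊕ (q ⊕ p)) ⊕ (e₋ ⊕ v)) ⊕ d₀ ⊜ (q ⊕ ((p ⊕ d₀) ⊕ v)) ⊕ (e₁ ⊕ e₋)) refl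

  -- The z-terms of `D-E 0` and `E-V 1` cancel, leaving D 1 = Q D 1. The added `0ℤ` gives this the
  -- form that `geometric-nonneg` expects.
  D₁-rec : ∀ n → D 1 n ≡ shift (m ℕ.* 1) (D 1) n + 0ℤ
  D₁-rec n = eliminate _ _ _ _ (D-E 0 n) (E-V 1 n)
    (shift-vanish (a ℕ.+ a) (suc n) n (λ _ _ → refl) (ℕ.m≤n+m (suc n) (a ℕ.+ a)))
    (shift-cong a (λ i → shift-m*0 (B 0 0) i) n)
    where
    eliminate : ∀ d₁ d₀ e₁ q {z e₀} → d₁ + d₀ ≡ e₁ + z → e₁ ≡ e₀ + q → z ≡ 0ℤ → e₀ ≡ d₀ → d₁ ≡ q + 0ℤ
    eliminate d₁ d₀ e₁ q h refl refl refl = +-cancelʳ d₀ _ _ (trans h (rearrange d₀ q))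
      where
      rearrange : ∀ d₀ q → (d₀ + q) + 0ℤ ≡ (q + 0ℤ) + d₀
      rearrange d₀ q = trans (+-assoc d₀ q 0ℤ) (+-comm d₀ (q + 0ℤ))

  -- `D-rec` steps from `k` to `k + 2`, hence two base cases; it also uses `V k`, so `V` is carried
  -- through the induction.
  D-V-nonneg : ∀ k → NonNegative (D k) × NonNegative (V k)
  D-V-nonneg zero = D₀-nonneg , D₀-nonneg
    where
    D₀-nonneg : NonNegative (D 0)
    D₀-nonneg = ⊛-nonneg u₀-nonneg v₀-nonneg
  D-V-nonneg (suc zero) = D₁-nonneg , shift-nonneg (m ℕ.* 1) D₁-nonneg
    where
    D₁-nonneg : NonNegative (D 1)
    D₁-nonneg = geometric-nonneg (m ℕ.* 1) {{ℕ.m*n≢0 m 1}} D₁-rec λ _ → ℤ.≤-refl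
  D-V-nonneg (suc (suc k)) with Dₖ-nonneg , Vₖ-nonneg ← D-V-nonneg k =
    D₂-nonneg , λ n → +-nonneg (shift-nonneg (m ℕ.* suc (suc k)) D₂-nonneg n)
                               (shift-nonneg (a ℕ.+ a ℕ.+ m ℕ.* suc k) Dₖ-nonneg n)
    where
    D₂-nonneg : NonNegative (D (suc (suc k)))
    D₂-nonneg = geometric-nonneg (m ℕ.* suc (suc k)) {{ℕ.m*n≢0 m (suc (suc k))}} (D-rec k)
      λ n → +-nonneg (+-nonneg (shift-nonneg (a ℕ.+ a ℕ.+ m ℕ.* suc k) Dₖ-nonneg n)
                               (shift-nonneg (a ℕ.+ a) Dₖ-nonneg n))
                     (shift-nonneg (a ℕ.+ a) Vₖ-nonneg n)

-- Indicators and weighted sums over lists.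

⟦_⟧ : Bool → ℤ
⟦ true ⟧  = 1ℤ
⟦ false ⟧ = 0ℤ

⟦∧⟧ : ∀ x y → ⟦ x ∧ y ⟧ ≡ ⟦ x ⟧ * ⟦ y ⟧
⟦∧⟧ true  y = sym (*-identityˡ ⟦ y ⟧)
⟦∧⟧ false y = sym (zeroˡ ⟦ y ⟧)

-- At most one `k` satisfies `d + k = n`, and `n < b` keeps it in range. If `d` exceeds `n` there is
-- none, and the shifted coefficient is 0 too.
Σ<-δ : ∀ d b f n → n ℕ.< b → Σ< b (λ k → ⟦ d ℕ.+ k ≡ᵇ n ⟧ * f k) ≡ shift d f n
Σ<-δ zero    (suc b) f zero    _ =
  trans (cong₂ _+_ (*-identityˡ (f 0)) (Σ<-zero b λ i _ → zeroˡ (f (suc i)))) (+-identityʳ (f 0))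
Σ<-δ zero    (suc b) f (suc n) (s≤s n<b) =
  trans (cong₂ _+_ (zeroˡ (f 0)) (Σ<-δ zero b (f ∘ suc) n n<b)) (+-identityˡ _)
Σ<-δ (suc d) b       f zero    _ = Σ<-zero b λ i _ → zeroˡ (f i)
Σ<-δ (suc d) b       f (suc n) n<b = Σ<-δ d b f n (ℕ.<-trans (ℕ.n<1+n n) n<b)

-- Terms with `j` at least `n` are shifted past coefficient `n`, so the cut-off of part sizes in
-- `partsUpTo` loses nothing.
Σ<-⊓ : ∀ n b (g : ℕ → Series) →
       Σ< (n ⊓ b) (λ j → g j (n ∸ suc j)) ≡ Σ< b (λ j → shift (suc j) (g j) n)
Σ<-⊓ zero    b       g = sym (Σ<-zero b λ _ _ → refl)
Σ<-⊓ (suc n) zero    g = refl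
Σ<-⊓ (suc n) (suc b) g = cong (_+_ _) (Σ<-⊓ n b (g ∘ suc))

∑ : {A : Set} → List A → (A → ℤ) → ℤ
∑ []       w = 0ℤ
∑ (x ∷ xs) w = w x + ∑ xs w

variable
  A I : Set

∑-cong : ∀ (xs : List A) {v w} → v ≗ w → ∑ xs v ≡ ∑ xs w
∑-cong []       eq = refl
∑-cong (x ∷ xs) eq = cong₂ _+_ (eq x) (∑-cong xs eq)

∑-+ : ∀ (xs : List A) v w → ∑ xs (λ x → v x + w x) ≡ ∑ xs v + ∑ xs w
∑-+ []       v w = sym (+-identityˡ 0ℤ)
∑-+ (x ∷ xs) v w = trans (cong (_+_ _) (∑-+ xs v w)) (interchange (v x) (w x) _ _)

∑-*ˡ : ∀ (xs : List A) c w → ∑ xs (λ x → c * w x) ≡ c * ∑ xs w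
∑-*ˡ []       c w = sym (zeroʳ c)
∑-*ˡ (x ∷ xs) c w = trans (cong (_+_ _) (∑-*ˡ xs c w)) (sym (distribˡ c (w x) _))

∑-++ : ∀ (xs ys : List A) w → ∑ (xs ++ ys) w ≡ ∑ xs w + ∑ ys w
∑-++ []       ys w = sym (+-identityˡ _)
∑-++ (x ∷ xs) ys w = trans (cong (_+_ _) (∑-++ xs ys w)) (sym (+-assoc (w x) _ _))

∑-if : ∀ b (x : A) w → ∑ (if b then [ x ] else []) w ≡ ⟦ b ⟧ * w x
∑-if true  x w = trans (+-identityʳ (w x)) (sym (*-identityˡ (w x)))
∑-if false x w = sym (zeroˡ (w x))

∑-applyUpTo : ∀ (f : ℕ → A) n w → ∑ (applyUpTo f n) w ≡ Σ< n (w ∘ f)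
∑-applyUpTo f zero    w = refl
∑-applyUpTo f (suc n) w = cong (_+_ _) (∑-applyUpTo (f ∘ suc) n w)

∑-concatMap : ∀ (f : I → List A) is w → ∑ (concatMap f is) w ≡ ∑ is (λ i → ∑ (f i) w)
∑-concatMap f []       w = refl
∑-concatMap f (i ∷ is) w = trans (∑-++ (f i) (concatMap f is) w) (cong (_+_ _) (∑-concatMap f is w))

∑-concatMap-applyUpTo : ∀ (f : I → List A) (g : ℕ → I) n w →
  ∑ (concatMap f (applyUpTo g n)) w ≡ Σ< n (λ i → ∑ (f (g i)) w)
∑-concatMap-applyUpTo f g n w = trans (∑-concatMap f (applyUpTo g n) w) (∑-applyUpTo g n _)

∑-map : ∀ (f : I → A) is w → ∑ (map f is) w ≡ ∑ is (w ∘ f)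
∑-map f []       w = refl
∑-map f (i ∷ is) w = cong (_+_ _) (∑-map f is w)

length-filter : ∀ (q : A → Bool) xs → + length (filter (λ x → q x Bool.≟ true) xs) ≡ ∑ xs (⟦_⟧ ∘ q)
length-filter q []       = refl
length-filter q (x ∷ xs) with q x
... | true  = trans (pos-+ 1 _) (cong (_+_ _) (length-filter q xs))
... | false = trans (length-filter q xs) (sym (+-identityˡ _))

-- Boolean comparisons and residues.

≤ᵇ-true : ∀ {i j} → i ℕ.≤ j → (i ≤ᵇ j) ≡ true
≤ᵇ-true = Equivalence.to Bool.T-≡ ∘ ℕ.≤⇒≤ᵇ

≤ᵇ-false : ∀ {i j} → j ℕ.< i → (i ≤ᵇ j) ≡ false
≤ᵇ-false {i} {j} j<i with i ≤ᵇ j in eq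
... | false = refl
... | true  = contradiction (ℕ.≤ᵇ⇒≤ i j (Equivalence.from Bool.T-≡ eq)) (ℕ.<⇒≱ j<i)

≡ᵇ-refl : ∀ i → (i ≡ᵇ i) ≡ true
≡ᵇ-refl i = Equivalence.to Bool.T-≡ (ℕ.≡⇒≡ᵇ i i refl)

≡ᵇ-false : ∀ {i j} → i ≢ j → (i ≡ᵇ j) ≡ false
≡ᵇ-false {i} {j} i≢j with i ≡ᵇ j in eq
... | false = refl
... | true  = contradiction (ℕ.≡ᵇ⇒≡ i j (Equivalence.from Bool.T-≡ eq)) i≢j

-- Equal remainders would make `d` a difference of two multiples of `n`, hence divisible by `n`,
-- although it is positive and smaller.
[m+d]%n≢m%n : ∀ m d n .{{_ : NonZero n}} .{{_ : NonZero d}} → d ℕ.< n → (m ℕ.+ d) % n ≢ m % n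
[m+d]%n≢m%n m d n d<n eq = ℕ.<⇒≱ d<n (∣⇒≤ (∣m+n∣m⇒∣n (divides ((m ℕ.+ d) / n) multiple) (n∣m*n (m / n))))
  where
  multiple : m / n ℕ.* n ℕ.+ d ≡ (m ℕ.+ d) / n ℕ.* n
  multiple = ℕ.+-cancelˡ-≡ (m % n) _ _ (begin
    m % n ℕ.+ (m / n ℕ.* n ℕ.+ d)             ≡⟨ ℕ.+-assoc (m % n) _ d ⟨
    m % n ℕ.+ m / n ℕ.* n ℕ.+ d               ≡⟨ cong (ℕ._+ d) (m≡m%n+[m/n]*n m n) ⟨
    m ℕ.+ d                                   ≡⟨ m≡m%n+[m/n]*n (m ℕ.+ d) n ⟩
    (m ℕ.+ d) % n ℕ.+ (m ℕ.+ d) / n ℕ.* n     ≡⟨ cong (ℕ._+ (m ℕ.+ d) / n ℕ.* n) eq ⟩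
    m % n ℕ.+ (m ℕ.+ d) / n ℕ.* n             ∎)

-- Partitions into parts from one residue class.

module OneKind (a m : ℕ) .{{_ : NonZero a}} .{{_ : NonZero m}} where

  part? : ℕ → Bool
  part? p = (p % m ≡ᵇ a % m) ∧ (a ≤ᵇ p)

  one : Series
  one zero    = 1ℤ
  one (suc n) = 0ℤ

  -- U b r is the generating function of the partitions into r admissible parts, each at most b.
  U : ℕ → ℕ → Series
  U b zero    = one
  U b (suc r) n = Σ< b (λ j → ⟦ part? (suc j) ⟧ * shift (suc j) (U (suc j) r) n)

  -- Parts are positive, so `r` of them sum to at least `r`.
  U-vanish : ∀ b r n → n ℕ.< r → U b r n ≡ 0ℤ
  U-vanish b (suc r) n n<1+r = Σ<-zero b λ j _ →
    trans (cong (⟦ part? (suc j) ⟧ *_) (shift-vanish (suc j) r n (λ k → U-vanish (suc j) r k)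
            (ℕ.<-≤-trans n<1+r (s≤s (ℕ.m≤n+m r j)))))
          (zeroʳ ⟦ part? (suc j) ⟧)

  -- The bridge from enumerated lists to `U`. The weight `h` is arbitrary so that the induction can
  -- absorb the first part into it; `R` exceeds the fuel, which bounds the number of parts.
  partsOK-sum : ∀ f n b R (h : ℕ → ℕ → ℤ) → n ℕ.≤ f → f ℕ.< R →
    ∑ (partsUpTo f n b) (λ λ′ → ⟦ partsOK a m λ′ ⟧ * h (ν λ′) ∣ λ′ ∣ₚ) ≡ Σ< R (λ r → U b r n * h r n)
  partsOK-sum zero    zero b (suc R) h _ _ = cong (_+_ _) (sym (Σ<-zero R λ r _ →
    trans (cong (_* h (suc r) 0) (U-vanish b (suc r) 0 (s≤s z≤n))) (zeroˡ _)))
  partsOK-sum (suc f) zero b (suc R) h _ _ = cong (_+_ _) (sym (Σ<-zero R λ r _ →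
    trans (cong (_* h (suc r) 0) (U-vanish b (suc r) 0 (s≤s z≤n))) (zeroˡ _)))
  partsOK-sum (suc f) (suc n) b (suc R) h (s≤s n≤f) (s≤s f<R) = begin
    ∑ (partsUpTo (suc f) (suc n) b) w
      ≡⟨ ∑-concatMap-applyUpTo (λ p → map (p ∷_) (partsUpTo f (suc n ∸ p) p)) suc (suc n ⊓ b) w ⟩
    Σ< (suc n ⊓ b) (λ j → ∑ (map (suc j ∷_) (partsUpTo f (n ∸ j) (suc j))) w)
      ≡⟨ Σ<-cong (suc n ⊓ b) first-part ⟩
    Σ< (suc n ⊓ b) (λ j → Σ< R (λ r → ⟦ part? (suc j) ⟧ * U (suc j) r (n ∸ j) * h (suc r) (suc n)))
      ≡⟨ Σ<-swap (suc n ⊓ b) R _ ⟩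
    Σ< R (λ r → Σ< (suc n ⊓ b) (λ j → ⟦ part? (suc j) ⟧ * U (suc j) r (n ∸ j) * h (suc r) (suc n)))
      ≡⟨ Σ<-cong R (λ r _ → number-of-parts r) ⟩
    Σ< R (λ r → U b (suc r) (suc n) * h (suc r) (suc n))
      -- The summand for no parts is zero, because the number to be partitioned is positive.
      ≡⟨ +-identityˡ _ ⟨
    0ℤ + Σ< R (λ r → U b (suc r) (suc n) * h (suc r) (suc n))
      ≡⟨ cong₂ _+_ (zeroˡ (h 0 (suc n))) refl ⟨
    Σ< (suc R) (λ r → U b r (suc n) * h r (suc n)) ∎
    where
    w : List ℕ → ℤ
    w λ′ = ⟦ partsOK a m λ′ ⟧ * h (ν λ′) ∣ λ′ ∣ₚ

    first-part : ∀ j → j ℕ.< suc n ⊓ b → ∑ (map (suc j ∷_) (partsUpTo f (n ∸ j) (suc j))) w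
      ≡ Σ< R (λ r → ⟦ part? (suc j) ⟧ * U (suc j) r (n ∸ j) * h (suc r) (suc n))
    first-part j j< = begin
      ∑ (map (suc j ∷_) ps) w
        ≡⟨ ∑-map (suc j ∷_) ps w ⟩
      ∑ ps (λ λ′ → w (suc j ∷ λ′))
        ≡⟨ ∑-cong ps (λ λ′ → trans (cong (_* h (suc (ν λ′)) (suc j ℕ.+ ∣ λ′ ∣ₚ)) (admissible λ′)) (*-assoc ⟦ part? (suc j) ⟧ _ _)) ⟩
      ∑ ps (λ λ′ → ⟦ part? (suc j) ⟧ * (⟦ partsOK a m λ′ ⟧ * h (suc (ν λ′)) (suc j ℕ.+ ∣ λ′ ∣ₚ)))
        ≡⟨ ∑-*ˡ ps ⟦ part? (suc j) ⟧ _ ⟩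
      ⟦ part? (suc j) ⟧ * ∑ ps (λ λ′ → ⟦ partsOK a m λ′ ⟧ * h (suc (ν λ′)) (suc j ℕ.+ ∣ λ′ ∣ₚ))
        ≡⟨ cong (⟦ part? (suc j) ⟧ *_) (partsOK-sum f (n ∸ j) (suc j) R (λ r x → h (suc r) (suc j ℕ.+ x))
             (ℕ.≤-trans (ℕ.m∸n≤m n j) n≤f) f<R) ⟩
      ⟦ part? (suc j) ⟧ * Σ< R (λ r → U (suc j) r (n ∸ j) * h (suc r) (suc j ℕ.+ (n ∸ j)))
        ≡⟨ Σ<-*ˡ R ⟦ part? (suc j) ⟧ _ ⟨
      Σ< R (λ r → ⟦ part? (suc j) ⟧ * (U (suc j) r (n ∸ j) * h (suc r) (suc j ℕ.+ (n ∸ j))))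
        ≡⟨ Σ<-cong R (λ r _ → trans (cong (λ x → ⟦ part? (suc j) ⟧ * (U (suc j) r (n ∸ j) * h (suc r) x))
             (cong suc (ℕ.m+[n∸m]≡n j≤n))) (sym (*-assoc ⟦ part? (suc j) ⟧ _ _))) ⟩
      Σ< R (λ r → ⟦ part? (suc j) ⟧ * U (suc j) r (n ∸ j) * h (suc r) (suc n)) ∎
      where
      ps = partsUpTo f (n ∸ j) (suc j)
      j≤n : j ℕ.≤ n
      j≤n = ℕ.s≤s⁻¹ (ℕ.≤-trans j< (ℕ.m⊓n≤m (suc n) b))
      admissible : ∀ λ′ → ⟦ partsOK a m (suc j ∷ λ′) ⟧ ≡ ⟦ part? (suc j) ⟧ * ⟦ partsOK a m λ′ ⟧
      admissible λ′ = trans (cong ⟦_⟧ (sym (Bool.∧-assoc (suc j % m ≡ᵇ a % m) _ _))) (⟦∧⟧ (part? (suc j)) _)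

    number-of-parts : ∀ r →
      Σ< (suc n ⊓ b) (λ j → ⟦ part? (suc j) ⟧ * U (suc j) r (n ∸ j) * h (suc r) (suc n))
        ≡ U b (suc r) (suc n) * h (suc r) (suc n)
    number-of-parts r = begin
      Σ< (suc n ⊓ b) (λ j → ⟦ part? (suc j) ⟧ * U (suc j) r (n ∸ j) * c)
        ≡⟨ Σ<-cong (suc n ⊓ b) (λ j _ → *-comm _ c) ⟩
      Σ< (suc n ⊓ b) (λ j → c * (⟦ part? (suc j) ⟧ * U (suc j) r (n ∸ j)))
        ≡⟨ Σ<-*ˡ (suc n ⊓ b) c _ ⟩
      c * Σ< (suc n ⊓ b) (λ j → ⟦ part? (suc j) ⟧ * U (suc j) r (n ∸ j))
        ≡⟨ *-comm c _ ⟩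
      Σ< (suc n ⊓ b) (λ j → ⟦ part? (suc j) ⟧ * U (suc j) r (n ∸ j)) * c
        ≡⟨ cong (_* c) (Σ<-⊓ (suc n) b (λ j k → ⟦ part? (suc j) ⟧ * U (suc j) r k)) ⟩
      Σ< b (λ j → shift (suc j) (λ k → ⟦ part? (suc j) ⟧ * U (suc j) r k) (suc n)) * c
        ≡⟨ cong (_* c) (Σ<-cong b λ j _ → shift-*ˡ (suc j) ⟦ part? (suc j) ⟧ (U (suc j) r) (suc n)) ⟩
      U b (suc r) (suc n) * c ∎
      where c = h (suc r) (suc n)

  U-suc : ∀ b r n → U (suc b) (suc r) n
    ≡ U b (suc r) n + ⟦ part? (suc b) ⟧ * shift (suc b) (U (suc b) r) n
  U-suc b r n = Σ<-last b (λ j → ⟦ part? (suc j) ⟧ * shift (suc j) (U (suc j) r) n)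

  -- Bounds along the arithmetic progression of admissible parts.

  part?-< : ∀ {p} → p ℕ.< a → part? p ≡ false
  part?-< {p} p<a = trans (cong ((p % m ≡ᵇ a % m) ∧_) (≤ᵇ-false p<a)) (Bool.∧-zeroʳ (p % m ≡ᵇ a % m))

  part?-progression : ∀ j → part? (a ℕ.+ m ℕ.* j) ≡ true
  part?-progression j = cong₂ _∧_
    (trans (cong (_≡ᵇ a % m) (trans (cong (λ x → (a ℕ.+ x) % m) (ℕ.*-comm m j)) ([m+kn]%n≡m%n a j m))) (≡ᵇ-refl (a % m)))
    (≤ᵇ-true (ℕ.m≤m+n a (m ℕ.* j)))

  part?-gap : ∀ j i → suc i ℕ.< m → part? (suc (a ℕ.+ m ℕ.* j ℕ.+ i)) ≡ false
  part?-gap j i i<m = cong (_∧ (a ≤ᵇ suc (x ℕ.+ i))) (≡ᵇ-false λ eq → [m+d]%n≢m%n x (suc i) m i<m (begin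
    (x ℕ.+ suc i) % m             ≡⟨ cong (_% m) (ℕ.+-suc x i) ⟩
    suc (x ℕ.+ i) % m             ≡⟨ eq ⟩
    a % m                         ≡⟨ [m+kn]%n≡m%n a j m ⟨
    (a ℕ.+ j ℕ.* m) % m           ≡⟨ cong (λ y → (a ℕ.+ y) % m) (ℕ.*-comm j m) ⟩
    x % m                         ∎))
    where x = a ℕ.+ m ℕ.* j

  W : ℕ → ℕ → Series
  W j = U (a ℕ.+ m ℕ.* j)

  -- W at j - 1, where no admissible part is allowed for j = 0.
  W⁻ : ℕ → ℕ → Series
  W⁻ zero    r n = 0ℤ
  W⁻ (suc j) r   = W j (suc r)

  shift-0 : ∀ d n → shift d (λ _ → 0ℤ) n ≡ 0ℤ
  shift-0 d n = shift-vanish d (suc n) n (λ _ _ → refl) (ℕ.m≤n+m (suc n) d)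

  U-gap : ∀ b d r n → (∀ i → i ℕ.< d → part? (suc (b ℕ.+ i)) ≡ false) → U (b ℕ.+ d) (suc r) n ≡ U b (suc r) n
  U-gap b d r n gap = begin
    U (b ℕ.+ d) (suc r) n
      ≡⟨ Σ<-split b d h ⟩
    U b (suc r) n + Σ< d (λ i → h (b ℕ.+ i))
      ≡⟨ cong (_+_ _) (Σ<-zero d λ i i<d → trans (cong (λ x → ⟦ x ⟧ * shift (suc (b ℕ.+ i)) (U (suc (b ℕ.+ i)) r) n) (gap i i<d)) (zeroˡ _)) ⟩
    U b (suc r) n + 0ℤ
      ≡⟨ +-identityʳ _ ⟩
    U b (suc r) n ∎
    where
    h : ℕ → ℤ
    h j = ⟦ part? (suc j) ⟧ * shift (suc j) (U (suc j) r) n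

  U-part : ∀ {c} b r n → suc b ≡ c → part? c ≡ true → U c (suc r) n ≡ U b (suc r) n + shift c (U c r) n
  U-part b r n refl ok = trans (U-suc b r n)
    (cong (_+_ _) (trans (cong (λ x → ⟦ x ⟧ * shift (suc b) (U (suc b) r) n) ok) (*-identityˡ _)))

  -- Either the value `a + m * j` does not occur, and the bound drops to the preceding admissible
  -- value, or one copy of it is removed as a largest part.
  W-last : ∀ j r n → W j (suc r) n ≡ W⁻ j r n + shift (a ℕ.+ m ℕ.* j) (W j r) n
  -- Bound 0 is followed by `a - 1` inadmissible values, and each `a + m * j` by `m - 1` of them;
  -- the value after each gap is admissible.
  W-last zero r n = trans (U-part (ℕ.pred a) r n (trans (ℕ.suc-pred a) a≡) (part?-progression 0))
    (cong₂ _+_ (U-gap 0 (ℕ.pred a) r n λ i i< → part?-< (subst (suc (suc i) ℕ.≤_) (ℕ.suc-pred a) (s≤s i<))) refl)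
    where
    a≡ : a ≡ a ℕ.+ m ℕ.* 0
    a≡ = sym (trans (cong (a ℕ.+_) (ℕ.*-zeroʳ m)) (ℕ.+-identityʳ a))
  W-last (suc j) r n = trans (U-part (a ℕ.+ m ℕ.* j ℕ.+ ℕ.pred m) r n next (part?-progression (suc j)))
    (cong₂ _+_ (U-gap (a ℕ.+ m ℕ.* j) (ℕ.pred m) r n λ i i< → part?-gap j i (subst (suc (suc i) ℕ.≤_) (ℕ.suc-pred m) (s≤s i<))) refl)
    where
    next : suc (a ℕ.+ m ℕ.* j ℕ.+ ℕ.pred m) ≡ a ℕ.+ m ℕ.* suc j
    next = begin
      suc (a ℕ.+ m ℕ.* j ℕ.+ ℕ.pred m)    ≡⟨ ℕ.+-suc (a ℕ.+ m ℕ.* j) _ ⟨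
      a ℕ.+ m ℕ.* j ℕ.+ suc (ℕ.pred m)    ≡⟨ cong (a ℕ.+ m ℕ.* j ℕ.+_) (ℕ.suc-pred m) ⟩
      a ℕ.+ m ℕ.* j ℕ.+ m                 ≡⟨ exponent a m j ⟩
      a ℕ.+ m ℕ.* suc j                   ∎
      where
      exponent : ∀ a m j → a ℕ.+ m ℕ.* j ℕ.+ m ≡ a ℕ.+ m ℕ.* suc j
      exponent = ℕRing.solve-∀

  shift-W-last : ∀ d j r n → shift d (W j (suc r)) n ≡ shift d (W⁻ j r) n + shift d (shift (a ℕ.+ m ℕ.* j) (W j r)) n
  shift-W-last d j r n = trans (shift-cong d (W-last j r) n) (shift-+ d (W⁻ j r) _ n)

  shift-swap : ∀ c d c′ d′ f n → c ℕ.+ d ≡ c′ ℕ.+ d′ → shift c (shift d f) n ≡ shift c′ (shift d′ f) n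
  shift-swap c d c′ d′ f n eq = trans (shift-merge c d f eq n) (shift-∘ c′ d′ f n)

  -- W-last removes a largest part; this removes a smallest part a, or else lowers every part by m.
  W-first : ∀ j r n → W j (suc r) n ≡ shift a (W j r) n + shift (m ℕ.* suc r) (W⁻ j r) n
  W-first zero r n = begin
    W 0 (suc r) n                                         ≡⟨ W-last 0 r n ⟩
    0ℤ + shift (a ℕ.+ m ℕ.* 0) (W 0 r) n                  ≡⟨ +-comm 0ℤ _ ⟩
    shift (a ℕ.+ m ℕ.* 0) (W 0 r) n + 0ℤ
      ≡⟨ cong₂ _+_ (cong (λ d → shift d (W 0 r) n) (trans (cong (a ℕ.+_) (ℕ.*-zeroʳ m)) (ℕ.+-identityʳ a)))
                   (sym (shift-0 (m ℕ.* suc r) n)) ⟩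
    shift a (W 0 r) n + shift (m ℕ.* suc r) (W⁻ 0 r) n ∎
  -- A single part is both largest and smallest, so the new value `a + m * suc j` is read as
  -- `a + m * j` raised by `m`.
  W-first (suc j) zero n = begin
    W (suc j) 1 n
      ≡⟨ W-last (suc j) 0 n ⟩
    W j 1 n + shift (a ℕ.+ m ℕ.* suc j) one n
      ≡⟨ cong (_+ shift (a ℕ.+ m ℕ.* suc j) one n) (W-first j 0 n) ⟩
    (shift a one n + shift (m ℕ.* 1) (W⁻ j 0) n) + shift (a ℕ.+ m ℕ.* suc j) one n
      ≡⟨ +-assoc (shift a one n) _ _ ⟩
    shift a one n + (shift (m ℕ.* 1) (W⁻ j 0) n + shift (a ℕ.+ m ℕ.* suc j) one n)
      ≡⟨ cong (λ x → shift a one n + (shift (m ℕ.* 1) (W⁻ j 0) n + x)) (shift-merge (m ℕ.* 1) (a ℕ.+ m ℕ.* j) one (exponent a m j) n) ⟨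
    shift a one n + (shift (m ℕ.* 1) (W⁻ j 0) n + shift (m ℕ.* 1) (shift (a ℕ.+ m ℕ.* j) one) n)
      ≡⟨ cong (_+_ _) (shift-W-last (m ℕ.* 1) j 0 n) ⟨
    shift a one n + shift (m ℕ.* 1) (W j 1) n ∎
    where
    exponent : ∀ a m j → m ℕ.* 1 ℕ.+ (a ℕ.+ m ℕ.* j) ≡ a ℕ.+ m ℕ.* suc j
    exponent = ℕRing.solve-∀
  -- The two summands of `W-last` are expanded by induction, one with smaller `j` and one with
  -- smaller `r`. Operations at the two ends of a partition commute, so `W-last` reassembles the
  -- four terms.
  W-first (suc j) (suc r) n = begin
    W (suc j) (2 ℕ.+ r) n
      ≡⟨ W-last (suc j) (suc r) n ⟩
    W j (2 ℕ.+ r) n + shift e (W (suc j) (suc r)) n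
      ≡⟨ cong₂ _+_ (W-first j (suc r) n) (trans (shift-cong e (W-first (suc j) r) n) (shift-+ e (shift a (W (suc j) r)) _ n)) ⟩
    (shift a (W j (suc r)) n + shift d (W⁻ j (suc r)) n)
      + (shift e (shift a (W (suc j) r)) n + shift e (shift (m ℕ.* suc r) (W j (suc r))) n)
      ≡⟨ cong₂ (λ x y → (shift a (W j (suc r)) n + shift d (W⁻ j (suc r)) n) + (x + y))
           (shift-swap e a a e (W (suc j) r) n (ℕ.+-comm e a))
           (shift-swap e (m ℕ.* suc r) d (a ℕ.+ m ℕ.* j) (W j (suc r)) n (exponent a m j r)) ⟩
    (shift a (W j (suc r)) n + shift d (W⁻ j (suc r)) n)
      + (shift a (shift e (W (suc j) r)) n + shift d (shift (a ℕ.+ m ℕ.* j) (W j (suc r))) n)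
      ≡⟨ interchange (shift a (W j (suc r)) n) _ _ _ ⟩
    (shift a (W j (suc r)) n + shift a (shift e (W (suc j) r)) n)
      + (shift d (W⁻ j (suc r)) n + shift d (shift (a ℕ.+ m ℕ.* j) (W j (suc r))) n)
      ≡⟨ cong₂ _+_ (shift-W-last a (suc j) r n) (shift-W-last d j (suc r) n) ⟨
    shift a (W (suc j) (suc r)) n + shift d (W j (2 ℕ.+ r)) n ∎
    where
    e = a ℕ.+ m ℕ.* suc j
    d = m ℕ.* (2 ℕ.+ r)
    exponent : ∀ a m j r → a ℕ.+ m ℕ.* suc j ℕ.+ m ℕ.* suc r ≡ m ℕ.* (2 ℕ.+ r) ℕ.+ (a ℕ.+ m ℕ.* j)
    exponent = ℕRing.solve-∀

  -- Removing the bound on the parts.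

  p : ℕ → Series
  p r n = U n r n

  -- Parts larger than `n` are shifted past coefficient `n`, so all bounds from `n` on agree; the
  -- diagonal choice in `p` therefore imposes no bound.
  U-stable : ∀ r {b n} → n ℕ.≤ b → U b r n ≡ p r n
  U-stable zero          n≤b = refl
  U-stable (suc r) {b} {n} n≤b = trans (cong (λ x → U x (suc r) n) (sym (ℕ.m+[n∸m]≡n n≤b))) (begin
    U (n ℕ.+ (b ∸ n)) (suc r) n
      ≡⟨ Σ<-split n (b ∸ n) h ⟩
    p (suc r) n + Σ< (b ∸ n) (λ i → h (n ℕ.+ i))
      ≡⟨ cong (_+_ _) (Σ<-zero (b ∸ n) λ i _ → trans (cong (⟦ part? (suc (n ℕ.+ i)) ⟧ *_) (beyond i)) (zeroʳ _)) ⟩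
    p (suc r) n + 0ℤ
      ≡⟨ +-identityʳ _ ⟩
    p (suc r) n ∎)
    where
    h : ℕ → ℤ
    h j = ⟦ part? (suc j) ⟧ * shift (suc j) (U (suc j) r) n
    beyond : ∀ i → shift (suc (n ℕ.+ i)) (U (suc (n ℕ.+ i)) r) n ≡ 0ℤ
    beyond i = shift-vanish (suc (n ℕ.+ i)) 0 n (λ _ ()) (s≤s (ℕ.≤-trans (ℕ.m≤m+n n i) (ℕ.m≤m+n _ 0)))

  -- This is `W-first` at index `suc n`: both bounds that occur, `a + m * suc n` and `a + m * n`,
  -- are at least `n`, so `U-stable` applies to every coefficient involved.
  p-suc : ∀ r n → p (suc r) n ≡ shift a (p r) n + shift (m ℕ.* suc r) (p (suc r)) n
  p-suc r n = begin
    p (suc r) n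
      ≡⟨ U-stable (suc r) (bound (ℕ.n≤1+n n)) ⟨
    W (suc n) (suc r) n
      ≡⟨ W-first (suc n) r n ⟩
    shift a (W (suc n) r) n + shift (m ℕ.* suc r) (W n (suc r)) n
      ≡⟨ cong₂ _+_ (shift-cong≤ a n λ k k≤n → U-stable r (bound (ℕ.m≤n⇒m≤1+n k≤n)))
                   (shift-cong≤ (m ℕ.* suc r) n λ k k≤n → U-stable (suc r) (bound k≤n)) ⟩
    shift a (p r) n + shift (m ℕ.* suc r) (p (suc r)) n ∎
    where
    bound : ∀ {j k} → k ℕ.≤ j → k ℕ.≤ a ℕ.+ m ℕ.* j
    bound {j} k≤j = ℕ.≤-trans k≤j (ℕ.≤-trans (ℕ.m≤n*m j m) (ℕ.m≤n+m (m ℕ.* j) a))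

  -- Signs and the signed series.

  -- Recursion in steps of two follows the reduction of `r % 2`, so parity statements pass from `r`
  -- to `r + 2` by computation.
  sgn : ℕ → ℤ
  sgn zero          = 1ℤ
  sgn (suc zero)    = - 1ℤ
  sgn (suc (suc r)) = sgn r

  sgn-suc : ∀ r → sgn (suc r) + sgn r ≡ 0ℤ
  sgn-suc zero          = -‿inverseˡ 1ℤ
  sgn-suc (suc zero)    = -‿inverseʳ 1ℤ
  sgn-suc (suc (suc r)) = sgn-suc r

  even≡odd+sgn : ∀ r → ⟦ r % 2 ≡ᵇ 0 ⟧ ≡ ⟦ r % 2 ≡ᵇ 1 ⟧ + sgn r
  even≡odd+sgn zero          = sym (+-identityˡ 1ℤ)
  even≡odd+sgn (suc zero)    = sym (-‿inverseʳ 1ℤ)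
  even≡odd+sgn (suc (suc r)) = even≡odd+sgn r

  u : ℕ → Series
  u r n = sgn r * p r n

  -- Multiply `p-suc` by the sign of `suc r`; its z-term cancels against z times `u r`, which has
  -- the opposite sign.
  u-suc : ∀ r n → u (suc r) n + shift a (u r) n ≡ shift (m ℕ.* suc r) (u (suc r)) n
  u-suc r n = begin
    s′ * p (suc r) n + shift a (u r) n
      ≡⟨ cong₂ (λ x y → s′ * x + y) (p-suc r n) (shift-*ˡ a s (p r) n) ⟩
    s′ * (x + y) + s * x
      ≡⟨ cong (_+ s * x) (distribˡ s′ x y) ⟩
    (s′ * x + s′ * y) + s * x
      ≡⟨ swapʳ (s′ * x) (s′ * y) (s * x) ⟩
    (s′ * x + s * x) + s′ * y
      ≡⟨ cong (_+ s′ * y) (distribʳ x s′ s) ⟨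
    (s′ + s) * x + s′ * y
      ≡⟨ cong (λ z → z * x + s′ * y) (sgn-suc r) ⟩
    0ℤ * x + s′ * y
      ≡⟨ trans (cong (_+ s′ * y) (zeroˡ x)) (+-identityˡ _) ⟩
    s′ * y
      ≡⟨ shift-*ˡ (m ℕ.* suc r) s′ (p (suc r)) n ⟨
    shift (m ℕ.* suc r) (u (suc r)) n ∎
    where
    s  = sgn r
    s′ = sgn (suc r)
    x  = shift a (p r) n
    y  = shift (m ℕ.* suc r) (p (suc r)) n
    swapʳ : ∀ x y z → (x + y) + z ≡ (x + z) + y
    swapʳ =
      solve 3 (λ x y z → (x ⊕ y) ⊕ z ⊜ (x ⊕ z) ⊕ y) refl

  one-nonneg : NonNegative one
  one-nonneg zero    = +≤+ z≤n
  one-nonneg (suc n) = ℤ.≤-refl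

  u₀-nonneg : NonNegative (u 0)
  u₀-nonneg n = *-nonneg {1ℤ} (+≤+ z≤n) (one-nonneg n)

  -- Counting copartitions by their numbers of parts.

  open Antidiagonals a m u p u-suc p-suc u₀-nonneg one-nonneg

  -- A ground with `r` parts has size at least `r`. With the same bound for the sky, only finitely
  -- many `B r s` reach coefficient `n`.
  B-vanishˡ : ∀ n r s → suc n ℕ.≤ r → B r s n ≡ 0ℤ
  B-vanishˡ n r s n<r = Σ<-zero (suc n) λ i i<1+n →
    trans (cong (_* shift i (shift (s ℕ.* (m ℕ.* r)) (p s)) n)
            (trans (cong (sgn r *_) (U-vanish i r i (ℕ.<-≤-trans i<1+n n<r))) (zeroʳ (sgn r))))
          (zeroˡ _)

  B-vanishʳ : ∀ n r s → suc n ℕ.≤ s → B r s n ≡ 0ℤ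
  B-vanishʳ n r s n<s = Σ<-zero (suc n) λ i _ →
    trans (cong (u r i *_) (shift-vanish i s n
            (λ k k<s → shift-vanish c s k (λ l → U-vanish l s l) (ℕ.<-≤-trans k<s (ℕ.m≤n+m s c)))
            (ℕ.<-≤-trans n<s (ℕ.m≤n+m s i))))
          (zeroʳ (u r i))
    where c = s ℕ.* (m ℕ.* r)

  sign : List ℕ × List ℕ → ℤ
  sign (γ , σ) = sgn (ν γ)

  -- Grounds and then skies are grouped by number of parts and size. The size condition fixes the
  -- sky's size, and the sum left over ground sizes is a Cauchy product. The side `2 (n + 1)` lets
  -- the triangle cover the square of all relevant `r` and `s`.
  ∑-copartitions : ∀ n → ∑ (copartitions a a m n) sign ≡ triangle (suc n ℕ.+ suc n) (λ r s → B r s n)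
  ∑-copartitions n = begin
    ∑ (copartitions a a m n) sign
      ≡⟨ ∑-concatMap-applyUpTo (λ i → concatMap withGround (partitions i)) id N sign ⟩
    Σ< N (λ i → ∑ (concatMap withGround (partitions i)) sign)
      ≡⟨ Σ<-cong N (λ i _ → trans (∑-concatMap withGround (partitions i) sign) (∑-cong (partitions i) ground)) ⟩
    Σ< N (λ i → ∑ (partitions i) (λ γ → ⟦ partsOK a m γ ⟧ * G (ν γ) ∣ γ ∣ₚ))
      ≡⟨ Σ<-cong N (λ i i<N → partsOK-sum i i i N G ℕ.≤-refl i<N) ⟩
    Σ< N (λ i → Σ< N (λ r → p r i * G r i))
      ≡⟨ Σ<-swap N N (λ i r → p r i * G r i) ⟩
    Σ< N (λ r → Σ< N (λ i → p r i * G r i))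
      ≡⟨ Σ<-cong N (λ r _ → Σ<-cong N λ i _ → trans (cong (p r i *_) (G≡ r i)) (sym (Σ<-*ˡ N (p r i) (T r i)))) ⟩
    Σ< N (λ r → Σ< N (λ i → Σ< N (λ s → p r i * T r i s)))
      ≡⟨ Σ<-cong N (λ r _ → Σ<-swap N N (λ i s → p r i * T r i s)) ⟩
    Σ< N (λ r → Σ< N (λ s → Σ< N (λ i → p r i * T r i s)))
      ≡⟨ Σ<-cong N (λ r _ → Σ<-cong N λ s _ → Σ<-cong N λ i _ →
           trans (cong (λ x → p r i * (sgn r * x)) (shift-∘ i (s ℕ.* (m ℕ.* r)) (p s) n)) (rearrange (p r i) (sgn r) _)) ⟩
    Σ< N (λ r → Σ< N (λ s → B r s n))
      ≡⟨ triangle≡rectangle N N (λ r s → B r s n) (λ r s → B-vanishˡ n r s) (λ r s → B-vanishʳ n r s) ⟨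
    triangle (N ℕ.+ N) (λ r s → B r s n) ∎
    where
    N = suc n

    rearrange : ∀ x y z → x * (y * z) ≡ (y * x) * z
    rearrange x y z = trans (sym (*-assoc x y z)) (cong (_* z) (*-comm x y))

    pair : List ℕ → List ℕ → List (List ℕ × List ℕ)
    pair γ σ = if partsOK a m γ ∧ partsOK a m σ ∧ (copartitionSize m γ σ ≡ᵇ n) then [ (γ , σ) ] else []

    withGround : List ℕ → List (List ℕ × List ℕ)
    withGround γ = concatMap (λ k → concatMap (pair γ) (partitions k)) (upTo N)

    size? : ℕ → ℕ → ℕ → ℕ → ℤ
    size? r x s y = ⟦ x ℕ.+ s ℕ.* (m ℕ.* r) ℕ.+ y ≡ᵇ n ⟧

    skies : ℕ → ℕ → ℕ → ℤ
    skies r x k = ∑ (partitions k) (λ σ → ⟦ partsOK a m σ ⟧ * (size? r x (ν σ) ∣ σ ∣ₚ * sgn r))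

    -- The signed number of skies that complete a ground with `r` parts and size `x`. It sees the
    -- ground only through `r` and `x`, as `partsOK-sum` requires.
    G : ℕ → ℕ → ℤ
    G r x = Σ< N (skies r x)

    T : ℕ → ℕ → ℕ → ℤ
    T r i s = sgn r * shift (i ℕ.+ s ℕ.* (m ℕ.* r)) (p s) n

    ground : ∀ γ → ∑ (withGround γ) sign ≡ ⟦ partsOK a m γ ⟧ * G (ν γ) ∣ γ ∣ₚ
    ground γ = begin
      ∑ (withGround γ) sign
        ≡⟨ ∑-concatMap-applyUpTo (λ k → concatMap (pair γ) (partitions k)) id N sign ⟩
      Σ< N (λ k → ∑ (concatMap (pair γ) (partitions k)) sign)
        ≡⟨ Σ<-cong N (λ k _ → trans (∑-concatMap (pair γ) (partitions k) sign)
             (trans (∑-cong (partitions k) sky) (∑-*ˡ (partitions k) ⟦ partsOK a m γ ⟧ _))) ⟩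
      Σ< N (λ k → ⟦ partsOK a m γ ⟧ * skies (ν γ) ∣ γ ∣ₚ k)
        ≡⟨ Σ<-*ˡ N ⟦ partsOK a m γ ⟧ (skies (ν γ) ∣ γ ∣ₚ) ⟩
      ⟦ partsOK a m γ ⟧ * G (ν γ) ∣ γ ∣ₚ ∎
      where
      sky : ∀ σ → ∑ (pair γ σ) sign
                ≡ ⟦ partsOK a m γ ⟧ * (⟦ partsOK a m σ ⟧ * (size? (ν γ) ∣ γ ∣ₚ (ν σ) ∣ σ ∣ₚ * sgn (ν γ)))
      sky σ = begin
        ∑ (pair γ σ) sign
          ≡⟨ ∑-if (x ∧ y ∧ z) (γ , σ) sign ⟩
        ⟦ x ∧ y ∧ z ⟧ * sgn (ν γ)
          ≡⟨ cong (_* sgn (ν γ)) (trans (⟦∧⟧ x (y ∧ z)) (cong (⟦ x ⟧ *_) (⟦∧⟧ y z))) ⟩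
        ⟦ x ⟧ * (⟦ y ⟧ * ⟦ z ⟧) * sgn (ν γ)
          ≡⟨ reassoc ⟦ x ⟧ ⟦ y ⟧ ⟦ z ⟧ (sgn (ν γ)) ⟩
        ⟦ x ⟧ * (⟦ y ⟧ * (⟦ z ⟧ * sgn (ν γ))) ∎
        where
        x = partsOK a m γ
        y = partsOK a m σ
        z = copartitionSize m γ σ ≡ᵇ n
        reassoc : ∀ w x y z → w * (x * y) * z ≡ w * (x * (y * z))
        reassoc w x y z = trans (*-assoc w (x * y) z) (cong (w *_) (*-assoc x y z))

    -- After `partsOK-sum` on the skies, `Σ<-δ` collapses the sum over sky sizes to a single shifted
    -- coefficient.
    G≡ : ∀ r i → G r i ≡ Σ< N (T r i)
    G≡ r i = begin
      G r i
        ≡⟨ Σ<-cong N (λ k k<N → partsOK-sum k k k N (λ s y → size? r i s y * sgn r) ℕ.≤-refl k<N) ⟩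
      Σ< N (λ k → Σ< N (λ s → p s k * (size? r i s k * sgn r)))
        ≡⟨ Σ<-swap N N (λ k s → p s k * (size? r i s k * sgn r)) ⟩
      Σ< N (λ s → Σ< N (λ k → p s k * (size? r i s k * sgn r)))
        ≡⟨ Σ<-cong N (λ s _ → Σ<-cong N λ k _ → reverse (p s k) (size? r i s k) (sgn r)) ⟩
      Σ< N (λ s → Σ< N (λ k → sgn r * (size? r i s k * p s k)))
        ≡⟨ Σ<-cong N (λ s _ → trans (Σ<-*ˡ N (sgn r) (λ k → size? r i s k * p s k))
             (cong (sgn r *_) (Σ<-δ (i ℕ.+ s ℕ.* (m ℕ.* r)) N (p s) n ℕ.≤-refl))) ⟩
      Σ< N (T r i) ∎
      where
      reverse : ∀ x y z → x * (y * z) ≡ z * (y * x)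
      reverse x y z = trans (*-comm x (y * z)) (trans (cong (_* x) (*-comm y z)) (*-assoc z y x))

  -- The inequality.

  cpᵉ≡cpᵒ+∑ : ∀ n → + cpᵉ a a m n ≡ + cpᵒ a a m n + ∑ (copartitions a a m n) sign
  cpᵉ≡cpᵒ+∑ n = begin
    + cpᵉ a a m n
      ≡⟨ length-filter groundEven cs ⟩
    ∑ cs (⟦_⟧ ∘ groundEven)
      ≡⟨ ∑-cong cs (λ (γ , _) → even≡odd+sgn (ν γ)) ⟩
    ∑ cs (λ x → ⟦ groundOdd x ⟧ + sign x)
      ≡⟨ ∑-+ cs (⟦_⟧ ∘ groundOdd) sign ⟩
    ∑ cs (⟦_⟧ ∘ groundOdd) + ∑ cs sign
      ≡⟨ cong (_+ ∑ cs sign) (length-filter groundOdd cs) ⟨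
    + cpᵒ a a m n + ∑ cs sign ∎
    where cs = copartitions a a m n

  -- The even count exceeds the odd one by coefficient `n` of the sum of `D t` over `t < 2 (n + 1)`,
  -- and each `D t` is non-negative.
  cpᵒ≤cpᵉ : ∀ n → cpᵒ a a m n ℕ.≤ cpᵉ a a m n
  cpᵒ≤cpᵉ n = ℤ.drop‿+≤+ (subst (+ cpᵒ a a m n ≤_) (sym (cpᵉ≡cpᵒ+∑ n))
    (i≤i+j (+ cpᵒ a a m n) (subst (0ℤ ≤_) (sym (∑-copartitions n))
      (triangle-nonneg (suc n ℕ.+ suc n) (λ r s → B r s n) λ t → proj₁ (D-V-nonneg t) n))))

theorem5 : (a m n : ℕ) .{{_ : NonZero a}} .{{_ : NonZero m}} →
    cpᵒ a a m n ℕ.≤ cpᵉ a a m n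
theorem5 a m n = OneKind.cpᵒ≤cpᵉ a m n
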